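{- Let $a$ be a positive integer, let $\ell = a+1$, and let $\mathcal{F}_{a,2}$ denote the family of $a$-locally bipartite graphs. Then \[\delta_{\chi}(\mathcal{F}_{a,2}, \ell + 1) = 1 - \frac{1}{\ell + 1/3}.\]
   Context: All graphs are finite and simple; $|G|$ denotes the number of vertices and $\delta(G)$ the minimum degree. A graph is $a$-locally bipartite if for every clique $K$ on $a$ vertices, the subgraph induced on the common neighbourhood of the vertices of $K$ is $2$-colourable. For a family $\mathcal{F}$ of graphs and a positive integer $k$, $\delta_{\chi}(\mathcal{F},k) = \inf\{d : \text{every } G \in \mathcal{F} \text{ with } \delta(G) \geqslant d|G| \text{ satisfies } \chi(G) \leqslant k\}$. -}

module Defs where

open import Data.Nat using (ℕ; suc; _+_; _*_)
open import Data.Bool using (Bool; true; false; T)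
open import Data.Fin using (Fin)
open import Data.List using (List; length; filterᵇ; allFin)
open import Data.Product using (Σ; ∃; _×_)
open import Data.Integer using (+_)
open import Data.Rational using (ℚ; _/_; _≤_; _<_; _-_; 1ℚ)
open import Relation.Binary.PropositionalEquality using (_≡_; _≢_)
open import Relation.Nullary using (¬_)
open import Function.Definitions using (Injective)

record Graph : Set where
  field
    n      : ℕ
    E      : Fin n → Fin n → Bool
    sym    : ∀ u v → E u v ≡ E v u
    irrefl : ∀ v → E v v ≡ false

open Graph public

∣_∣ᵥ : Graph → ℕ
∣ G ∣ᵥ = n G

Adj : (G : Graph) → Fin (n G) → Fin (n G) → Set
Adj G u v = T (E G u v)

deg : (G : Graph) → Fin (n G) → ℕ
deg G v = length (filterᵇ (E G v) (allFin (n G)))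

ℕ→ℚ : ℕ → ℚ
ℕ→ℚ m = (+ m) / 1

-- δ(G) ≥ d |G|   (δ(G) is the minimum degree; for |G| = 0 this is vacuous)
MinDegAtLeast : Graph → ℚ → Set
MinDegAtLeast G d = ∀ v → d Data.Rational.* ℕ→ℚ ∣ G ∣ᵥ ≤ ℕ→ℚ (deg G v)

Colourable : ℕ → Graph → Set
Colourable k G = Σ (Fin (n G) → Fin k) λ c → ∀ u v → Adj G u v → c u ≢ c v

IsClique : (G : Graph) (a : ℕ) → (Fin a → Fin (n G)) → Set
IsClique G a K = Injective _≡_ _≡_ K × (∀ i j → i ≢ j → Adj G (K i) (K j))

InCommonNbhd : (G : Graph) {a : ℕ} → (Fin a → Fin (n G)) → Fin (n G) → Set
InCommonNbhd G {a} K v = ∀ i → Adj G (K i) v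

LocallyBipartite : ℕ → Graph → Set
LocallyBipartite a G =
  ∀ (K : Fin a → Fin (n G)) → IsClique G a K →
    Σ (Fin (n G) → Fin 2) λ c →
      ∀ u v → InCommonNbhd G K u → InCommonNbhd G K v → Adj G u v → c u ≢ c v

Forces : (Graph → Set) → ℕ → ℚ → Set
Forces F k d = ∀ (G : Graph) → F G → MinDegAtLeast G d → Colourable k G

-- δ_χ(F,k) = c, i.e. c is the infimum of the (upward closed) set of d with Forces F k d:
-- every d > c lies in the set, and no d < c does.  (Rationals d suffice, being dense.)
ChromaticThresholdIs : (Graph → Set) → ℕ → ℚ → Set
ChromaticThresholdIs F k c =
  (∀ d → c < d → Forces F k d) × (∀ d → d < c → ¬ Forces F k d)

-- 1 - 1/(ℓ + 1/3) = 1 - 3/(3ℓ + 1)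
thresholdValue : ℕ → ℚ
thresholdValue ℓ = 1ℚ - ((+ 3) / suc (3 * ℓ))

{-# OPTIONS --safe #-}
module Submission where

open import Defs
open import Data.Bool using (Bool; true; false; T; _∧_; _∨_; if_then_else_)
import Data.Bool.Properties as Bool
open import Data.Bool.Properties using (T?)
open import Data.Empty using (⊥; ⊥-elim)
open import Data.Fin using (Fin; zero; suc; punchIn; punchOut; splitAt; toℕ; _↑ʳ_; _≟_)
import Data.Fin.Properties as Fin
open import Data.Fin.Properties using (all?; any?; injective⇒≤; pigeonhole; punchIn-injective; punchIn-punchOut; punchInᵢ≢i; punchOut-injective; ¬Fin0)
import Data.Integer as ℤ
import Data.Integer.Properties as ℤ
import Data.Integer.Solver as ℤSolver
open import Data.List using (List; []; _∷_; _++_; allFin; concat; filterᵇ; length; lookup; map; replicate; tabulate)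
open import Data.List.Membership.Propositional using (_∈_)
open import Data.List.Membership.Propositional.Properties using (∈-allFin; ∈-filter⁺; ∈-filter⁻; ∈-lookup)
open import Data.List.Properties using (length-++; length-tabulate; map-tabulate; tabulate-lookup)
open import Data.List.Relation.Unary.All using (All; []; _∷_)
open import Data.List.Relation.Unary.All.Properties using (tabulate⁻)
open import Data.List.Relation.Unary.Any using (index)
open import Data.List.Relation.Unary.Any.Properties using (lookup-index)
open import Data.Nat using (ℕ; zero; suc; _+_; _*_; _∸_; _/_; _%_; _≤_; _<_; _≤ᵇ_; _<ᵇ_; _≤?_; _<?_; z≤n; s≤s; >-nonZero)
open import Data.Nat.DivMod using (/-monoˡ-≤; m*n/n≡m; m/n*n≤m)
open import Data.Nat.ListAction using (sum)
open import Data.Nat.Properties hiding (_≟_)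
open import Data.Nat.Solver using (module +-*-Solver)
open import Data.Product using (Σ; ∃; ∃₂; _×_; _,_; proj₁; proj₂)
open import Data.Rational using (toℚᵘ; 1ℚ)
import Data.Rational as ℚ
import Data.Rational.Properties as ℚ
open import Data.Rational.Unnormalised using (ℚᵘ; mkℚᵘ; _≃_; 1ℚᵘ)
import Data.Rational.Unnormalised as ℚᵘ
import Data.Rational.Unnormalised.Properties as ℚᵘ
open import Data.Sum using (_⊎_; inj₁; inj₂)
open import Data.Unit using (⊤; tt)
open import Function using (_∘_; case_of_; id)
open import Relation.Binary.PropositionalEquality using (_≡_; _≢_; cong; cong₂; refl; subst; subst₂; trans) renaming (sym to ≡-sym)
open import Relation.Nullary using (¬_; Dec; no; yes)
open import Relation.Nullary.Decidable using (True; from-yes; map′; toWitness; ¬?; _×-dec_; _→-dec_)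

-- Lower bound: the complement of the 7-cycle, joined with a - 1 independent sets of size 3.
--
-- Upper bound. Write b = a + 1 and let every vertex have at most m non-neighbours, (3b+1)m < 3|G|. The
-- only counting used is averaging: if 3 L ≤ k (3b+1), then some vertex misses fewer than k vertices of
-- any given list of L vertices. By induction on a the neighbourhoods are b-colourable, so it suffices
-- to glue b-colourings κ p of the neighbourhoods N(p) to a (b+1)-colouring.
--
-- b = 2. Call two vertices twins if their common neighbourhood contains an edge. Averaging over its 7
-- vertices excludes the Moser spindle, so twins of a common vertex are not adjacent. Fix a triangle
-- xyz. A twin of x, y or z gets the colour of that vertex. For any other vertex e there are common
-- neighbours p of e and exactly one pair of triangle vertices, say x and y, and κ p says whether e is
-- coloured like x or like y. Each consistency check is an average over at most 9 vertices.
--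
-- b ≥ 3. Fix a (b+1)-clique K. Any two vertices u, v have a common neighbour p that misses only one
-- vertex of K, and κ p identifies the colour of v with that of some vertex of K. For adjacent p and q
-- the two answers agree, because in N(p) ∩ N(q) the colour of v is forced; and the set of all such p
-- is connected.

-- Counting non-neighbours

miss : Bool → ℕ
miss true  = 0
miss false = 1

-- Repeated entries count repeatedly, so a list serves as a weighting of the vertices.
misses : (G : Graph) → Fin (n G) → List (Fin (n G)) → ℕ
misses G w vs = sum (map (λ v → miss (E G v w)) vs)

-- A vertex is one of its own non-neighbours.
NonDegreeAtMost : ℕ → Graph → Set
NonDegreeAtMost m G = ∀ v → n G ≤ m + deg G v

sum-map-+ : ∀ {A : Set} (f g : A → ℕ) xs →
  sum (map (λ x → f x + g x) xs) ≡ sum (map f xs) + sum (map g xs)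
sum-map-+ f g [] = refl
sum-map-+ f g (x ∷ xs) rewrite sum-map-+ f g xs =
  solve 4 (λ a b c d → (a :+ b) :+ (c :+ d) := (a :+ c) :+ (b :+ d)) refl
    (f x) (g x) (sum (map f xs)) (sum (map g xs))
  where open +-*-Solver

sum-map-const : ∀ {A : Set} c (xs : List A) → sum (map (λ _ → c) xs) ≡ length xs * c
sum-map-const c [] = refl
sum-map-const c (x ∷ xs) = cong (c +_) (sum-map-const c xs)

sum-map-mono : ∀ {A : Set} {f g : A → ℕ} → (∀ x → f x ≤ g x) → ∀ xs →
  sum (map f xs) ≤ sum (map g xs)
sum-map-mono f≤g [] = z≤n
sum-map-mono f≤g (x ∷ xs) = +-mono-≤ (f≤g x) (sum-map-mono f≤g xs)

sum-swap : ∀ {A B : Set} (f : A → B → ℕ) xs ys →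
  sum (map (λ y → sum (map (λ x → f x y) xs)) ys) ≡ sum (map (λ x → sum (map (f x) ys)) xs)
sum-swap f [] ys = trans (sum-map-const 0 ys) (*-zeroʳ (length ys))
sum-swap f (x ∷ xs) ys =
  trans (sum-map-+ (f x) (λ y → sum (map (λ x → f x y) xs)) ys)
        (cong (sum (map (f x) ys) +_) (sum-swap f xs ys))

length-filterᵇ+misses : ∀ {A : Set} (f : A → Bool) xs →
  length (filterᵇ f xs) + sum (map (miss ∘ f) xs) ≡ length xs
length-filterᵇ+misses f [] = refl
length-filterᵇ+misses f (x ∷ xs) with f x
... | true  = cong suc (length-filterᵇ+misses f xs)
... | false = trans (+-suc _ _) (cong suc (length-filterᵇ+misses f xs))

length-allFin : ∀ k → length (allFin k) ≡ k
length-allFin k = length-tabulate id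

nonNeighbours≤ : ∀ {m} G → NonDegreeAtMost m G → ∀ v →
  sum (map (λ w → miss (E G v w)) (allFin (n G))) ≤ m
nonNeighbours≤ {m} G bd v = +-cancelˡ-≤ (deg G v) _ _ (begin
  deg G v + sum (map (λ w → miss (E G v w)) (allFin (n G)))
    ≡⟨ length-filterᵇ+misses (E G v) (allFin (n G)) ⟩
  length (allFin (n G))  ≡⟨ length-allFin (n G) ⟩
  n G                    ≤⟨ bd v ⟩
  m + deg G v            ≡⟨ +-comm m _ ⟩
  deg G v + m            ∎)
  where open ≤-Reasoning

-- Double counting of the non-adjacent pairs between vs and the vertex set.
exists-few-misses : ∀ {m} G → NonDegreeAtMost m G → ∀ vs k →
  length vs * m < k * n G → ∃ λ w → misses G w vs < k
exists-few-misses {m} G bd vs k lt with any? (λ w → misses G w vs <? k)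
... | yes found = found
... | no  none  = ⊥-elim (<-irrefl refl (begin-strict
  length vs * m
    <⟨ lt ⟩
  k * n G
    ≡⟨ *-comm k (n G) ⟩
  n G * k
    ≡⟨ cong (_* k) (≡-sym (length-allFin (n G))) ⟩
  length V * k
    ≡⟨ ≡-sym (sum-map-const k V) ⟩
  sum (map (λ _ → k) V)
    ≤⟨ sum-map-mono (λ w → ≮⇒≥ (λ l → none (w , l))) V ⟩
  sum (map (λ w → misses G w vs) V)
    ≡⟨ sum-swap (λ v w → miss (E G v w)) vs V ⟩
  sum (map (λ v → sum (map (λ w → miss (E G v w)) V)) vs)
    ≤⟨ sum-map-mono (nonNeighbours≤ G bd) vs ⟩
  sum (map (λ _ → m) vs)
    ≡⟨ sum-map-const m vs ⟩
  length vs * m ∎))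
  where open ≤-Reasoning
        V = allFin (n G)

-- Equivalently, the minimum degree exceeds (1 - 1/(b + 1/3)) |G|; the bound m is kept when passing to links.
record Dense (m b : ℕ) (G : Graph) : Set where
  field
    nonDegree : NonDegreeAtMost m G
    large    : (3 * b + 1) * m < 3 * n G

open Dense public

scaled-bound : ∀ {L N b m} k → 3 * L ≤ suc k * (3 * b + 1) → (3 * b + 1) * m < 3 * N → L * m < suc k * N
scaled-bound {L} {N} {b} {m} k le lt = *-cancelˡ-< 3 _ _ (begin-strict
  3 * (L * m)                 ≡⟨ *-assoc 3 L m ⟨
  3 * L * m                   ≤⟨ *-monoˡ-≤ m le ⟩
  suc k * (3 * b + 1) * m     ≡⟨ *-assoc (suc k) (3 * b + 1) m ⟩
  suc k * ((3 * b + 1) * m)   <⟨ *-monoʳ-< (suc k) lt ⟩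
  suc k * (3 * N)             ≡⟨ *-assoc (suc k) 3 N ⟨
  suc k * 3 * N               ≡⟨ cong (_* N) (*-comm (suc k) 3) ⟩
  3 * suc k * N               ≡⟨ *-assoc 3 (suc k) N ⟩
  3 * (suc k * N)             ∎)
  where open ≤-Reasoning

-- On average a vertex misses at most `L m / |G|` entries of a list of length `L`, and
-- `m / |G| < 3 / (3b + 1)`. For `b = 2`, seven entries give at most two misses and nine give at
-- most three.
find : ∀ {m b} G → Dense m b G → ∀ vs k → 3 * length vs ≤ suc k * (3 * b + 1) →
  ∃ λ w → misses G w vs ≤ k
find {m} {b} G d vs k le =
  let w , few = exists-few-misses G (nonDegree d) vs (suc k) (scaled-bound {length vs} {n G} {b} {m} k le (large d))
  in w , ≤-pred few

-- Cliques, local colourings and links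

Adj-sym : ∀ G {u v} → Adj G u v → Adj G v u
Adj-sym G {u} {v} = subst T (sym G u v)

Adj-irrefl : ∀ G {u v} → Adj G u v → u ≢ v
Adj-irrefl G {u} a refl = subst T (irrefl G u) a

Clique : (G : Graph) {k : ℕ} → (Fin k → Fin (n G)) → Set
Clique G K = ∀ i j → i ≢ j → Adj G (K i) (K j)

Clique⇒IsClique : ∀ G {k} (K : Fin k → Fin (n G)) → Clique G K → IsClique G k K
Clique⇒IsClique G K cl = inj , cl
  where
  inj : ∀ {i j} → K i ≡ K j → i ≡ j
  inj {i} {j} eq with i ≟ j
  ... | yes i≡j = i≡j
  ... | no  i≢j = ⊥-elim (Adj-irrefl G (cl i j i≢j) eq)

_◂_ : ∀ {A : Set} {k} → A → (Fin k → A) → Fin (suc k) → A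
(x ◂ f) zero    = x
(x ◂ f) (suc i) = f i

clique-◂ : ∀ G {k} p (K : Fin k → Fin (n G)) → Clique G K → (∀ i → Adj G p (K i)) → Clique G (p ◂ K)
clique-◂ G p K cl ad zero    zero    ne = ⊥-elim (ne refl)
clique-◂ G p K cl ad zero    (suc j) ne = ad j
clique-◂ G p K cl ad (suc i) zero    ne = Adj-sym G (ad i)
clique-◂ G p K cl ad (suc i) (suc j) ne = cl i j (ne ∘ cong suc)

clique-∘ : ∀ G {k l} (K : Fin k → Fin (n G)) (f : Fin l → Fin k) →
  (∀ {i j} → f i ≡ f j → i ≡ j) → Clique G K → Clique G (K ∘ f)
clique-∘ G K f inj cl i j ne = cl (f i) (f j) (ne ∘ inj)

CliqueFree : ℕ → Graph → Set
CliqueFree k G = (K : Fin k → Fin (n G)) → ¬ Clique G K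

-- `κ p` is total for convenience; it is a colouring on the neighbourhood of `p` and arbitrary
-- elsewhere.
LocalColouring : ℕ → Graph → Set
LocalColouring b G = Σ (Fin (n G) → Fin (n G) → Fin b) λ κ →
  ∀ p u v → Adj G p u → Adj G p v → Adj G u v → κ p u ≢ κ p v

-- The `b + 1` vertices of `K` other than `K zero` lie in its neighbourhood, so two of them would
-- share one of the `b` colours.
localColouring⇒cliqueFree : ∀ {b} G → LocalColouring b G → CliqueFree (suc (suc b)) G
localColouring⇒cliqueFree G (κ , proper) K cl
  with i , j , i<j , eq ← pigeonhole ≤-refl (λ i → κ (K zero) (K (suc i))) =
  proper (K zero) _ _ (cl zero (suc i) λ ()) (cl zero (suc j) λ ())
    (cl (suc i) (suc j) (Fin.<⇒≢ i<j ∘ Fin.suc-injective)) eq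

-- The subgraph induced on the neighbourhood of `p`. Its vertices are the positions in the list of
-- neighbours, so its order is `deg G p` by definition.
link : (G : Graph) → Fin (n G) → Graph
link G p = record
  { n      = deg G p
  ; E      = λ i j → E G (lookup N i) (lookup N j)
  ; sym    = λ i j → sym G (lookup N i) (lookup N j)
  ; irrefl = λ i → irrefl G (lookup N i)
  }
  where N = filterᵇ (E G p) (allFin (n G))

module Link (G : Graph) (p : Fin (n G)) where

  N : List (Fin (n G))
  N = filterᵇ (E G p) (allFin (n G))

  ι : Fin (n (link G p)) → Fin (n G)
  ι = lookup N

  ι-adj : ∀ i → Adj G p (ι i)
  ι-adj i = proj₂ (∈-filter⁻ (T? ∘ E G p) {xs = allFin (n G)} (∈-lookup {xs = N} i))

  private
    in-N : ∀ {w} → Adj G p w → w ∈ N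
    in-N {w} a = ∈-filter⁺ (T? ∘ E G p) (∈-allFin w) a

  ι⁻¹ : ∀ {w} → Adj G p w → Fin (n (link G p))
  ι⁻¹ a = index (in-N a)

  ι-ι⁻¹ : ∀ {w} (a : Adj G p w) → ι (ι⁻¹ a) ≡ w
  ι-ι⁻¹ a = ≡-sym (lookup-index (in-N a))

  lift-clique : ∀ {k} (K : Fin k → Fin (n (link G p))) → Clique (link G p) K → Clique G (p ◂ (ι ∘ K))
  lift-clique K cl = clique-◂ G p (ι ∘ K) cl (λ i → ι-adj (K i))

length-filterᵇ-map : ∀ {A B : Set} (q : B → Bool) (f : A → B) xs →
  length (filterᵇ q (map f xs)) ≡ length (filterᵇ (q ∘ f) xs)
length-filterᵇ-map q f [] = refl
length-filterᵇ-map q f (x ∷ xs) with q (f x)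
... | true  = cong suc (length-filterᵇ-map q f xs)
... | false = length-filterᵇ-map q f xs

misses-filterᵇ : ∀ {A : Set} (q f : A → Bool) xs →
  sum (map (miss ∘ f) (filterᵇ q xs)) ≤ sum (map (miss ∘ f) xs)
misses-filterᵇ q f [] = z≤n
misses-filterᵇ q f (x ∷ xs) with q x
... | true  = +-monoʳ-≤ (miss (f x)) (misses-filterᵇ q f xs)
... | false = ≤-trans (misses-filterᵇ q f xs) (m≤n+m _ (miss (f x)))

-- Non-neighbours inside the link are non-neighbours in `G`.
link-nonDegree : ∀ {m} G p → NonDegreeAtMost m G → NonDegreeAtMost m (link G p)
link-nonDegree {m} G p bd i = begin
  length N
    ≡⟨ ≡-sym (length-filterᵇ+misses (E G (ι i)) N) ⟩
  length (filterᵇ (E G (ι i)) N) + sum (map (miss ∘ E G (ι i)) N)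
    ≤⟨ +-monoʳ-≤ _ (≤-trans (misses-filterᵇ (E G p) (E G (ι i)) (allFin (n G))) (nonNeighbours≤ G bd (ι i))) ⟩
  length (filterᵇ (E G (ι i)) N) + m
    ≡⟨ +-comm _ m ⟩
  m + length (filterᵇ (E G (ι i)) N)
    ≡⟨ cong (λ xs → m + length (filterᵇ (E G (ι i)) xs)) (≡-sym N≡) ⟩
  m + length (filterᵇ (E G (ι i)) (map ι (allFin (length N))))
    ≡⟨ cong (m +_) (length-filterᵇ-map (E G (ι i)) ι (allFin (length N))) ⟩
  m + deg (link G p) i ∎
  where
  open ≤-Reasoning
  open Link G p
  N≡ : map ι (allFin (length N)) ≡ N
  N≡ = trans (map-tabulate id ι) (tabulate-lookup N)

-- At most `m` vertices are lost, hence `3 m` on the right of `large`, and lowering `b` by one takes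
-- `3 m` from the left.
link-dense : ∀ {m b} G p → Dense m (suc b) G → Dense m b (link G p)
link-dense {m} {b} G p d = record
  { nonDegree = link-nonDegree G p (nonDegree d)
  ; large    = +-cancelˡ-< (3 * m) _ _ (begin-strict
      3 * m + (3 * b + 1) * m    ≡⟨ solve 2 (λ m b → con 3 :* m :+ (con 3 :* b :+ con 1) :* m := (con 3 :* (con 1 :+ b) :+ con 1) :* m) refl m b ⟩
      (3 * suc b + 1) * m        <⟨ large d ⟩
      3 * n G                    ≤⟨ *-monoʳ-≤ 3 (nonDegree d p) ⟩
      3 * (m + deg G p)          ≡⟨ *-distribˡ-+ 3 m (deg G p) ⟩
      3 * m + 3 * deg G p        ∎)
  }
  where open ≤-Reasoning
        open +-*-Solver

link-cliqueFree : ∀ {k} G p → CliqueFree (suc k) G → CliqueFree k (link G p)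
link-cliqueFree G p free K cl = free _ (Link.lift-clique G p K cl)

-- Adding `p` to a clique of the link gives a clique of `G` with the same common neighbourhood.
link-locallyBipartite : ∀ {a} G p → LocallyBipartite (suc a) G → LocallyBipartite a (link G p)
link-locallyBipartite G p lb K (_ , cl)
  with c , proper ← lb (p ◂ (Link.ι G p ∘ K)) (Clique⇒IsClique G _ (Link.lift-clique G p K cl))
  = c ∘ ι , λ u v u∈ v∈ → proper (ι u) (ι v) (extend u u∈) (extend v v∈)
  where
  open Link G p
  extend : ∀ u → InCommonNbhd (link G p) K u → InCommonNbhd G (p ◂ (ι ∘ K)) (ι u)
  extend u u∈ zero    = ι-adj u
  extend u u∈ (suc i) = u∈ i

links-colourable⇒localColouring : ∀ {b} G → (∀ p → Colourable (suc b) (link G p)) → LocalColouring (suc b) G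
links-colourable⇒localColouring {b} G col = κ , proper
  where
  κ : Fin (n G) → Fin (n G) → Fin (suc b)
  κ p u with T? (E G p u)
  ... | yes a = proj₁ (col p) (Link.ι⁻¹ G p a)
  ... | no  _ = zero
  proper : ∀ p u v → Adj G p u → Adj G p v → Adj G u v → κ p u ≢ κ p v
  proper p u v pu pv uv with T? (E G p u) | T? (E G p v)
  ... | yes a | yes a′ = proj₂ (col p) _ _ (subst T (≡-sym (cong₂ (E G) (ι-ι⁻¹ a) (ι-ι⁻¹ a′))) uv)
    where open Link G p
  ... | no ¬a | _      = ⊥-elim (¬a pu)
  ... | yes _ | no ¬a  = ⊥-elim (¬a pv)

-- Boolean sequents

-- A sequent says: if none of the conjunctions in refuted holds, then premise implies one of the
-- conjunctions in conclusion.
record Sequent : Set where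
  constructor _/_⊢_
  field
    refuted    : List (List Bool)
    premise    : Bool
    conclusion : List (List Bool)

infix 4 _/_⊢_

-- Curried, so that a partial application such as `noK₄ xy xz yz` is a proof of it.
Refuted : List Bool → Set
Refuted []       = ⊥
Refuted (b ∷ bs) = T b → Refuted bs

Conjunction : List Bool → Set
Conjunction []       = ⊤
Conjunction (b ∷ bs) = T b × Conjunction bs

Disjunction : List (List Bool) → Set
Disjunction []       = ⊥
Disjunction (c ∷ cs) = Conjunction c ⊎ Disjunction cs

Meaning : List (List Bool) → Bool → List (List Bool) → Set
Meaning []       p cs = T p → Disjunction cs
Meaning (r ∷ rs) p cs = Refuted r → Meaning rs p cs

allTrue : List Bool → Bool
allTrue []       = true
allTrue (b ∷ bs) = b ∧ allTrue bs

someTrue : List (List Bool) → Bool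
someTrue []       = false
someTrue (c ∷ cs) = allTrue c ∨ someTrue cs

valid : List (List Bool) → Bool → List (List Bool) → Bool
valid []       p cs = if p then someTrue cs else true
valid (r ∷ rs) p cs = if allTrue r then true else valid rs p cs

allTrue-sound : ∀ bs → T (allTrue bs) → Conjunction bs
allTrue-sound []          _ = tt
allTrue-sound (true ∷ bs) t = tt , allTrue-sound bs t

someTrue-sound : ∀ cs → T (someTrue cs) → Disjunction cs
someTrue-sound (c ∷ cs) t with allTrue c in eq
... | true  = inj₁ (allTrue-sound c (subst T (≡-sym eq) tt))
... | false = inj₂ (someTrue-sound cs t)

Refuted-sound : ∀ bs → Refuted bs → ¬ T (allTrue bs)
Refuted-sound []          r _ = r
Refuted-sound (true ∷ bs) r t = Refuted-sound bs (r tt) t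

valid-sound : ∀ rs p cs → T (valid rs p cs) → Meaning rs p cs
valid-sound []       true cs t _ = someTrue-sound cs t
valid-sound (r ∷ rs) p    cs t ref with allTrue r in eq
... | true  = ⊥-elim (Refuted-sound r ref (subst T (≡-sym eq) tt))
... | false = valid-sound rs p cs t

Nary : ℕ → Set
Nary zero    = Sequent
Nary (suc k) = Bool → Nary k

tautology : ∀ k → Nary k → Bool
tautology zero    (rs / p ⊢ cs) = valid rs p cs
tautology (suc k) s             = tautology k (s true) ∧ tautology k (s false)

Universally : ∀ k → Nary k → Set
Universally zero    (rs / p ⊢ cs) = Meaning rs p cs
Universally (suc k) s             = ∀ b → Universally k (s b)

-- Reflection: type checking evaluates all truth assignments, and `tt` certifies the outcome. The
-- variables will be the adjacencies between a vertex found by averaging and the vertices of a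
-- configuration.
tauto : ∀ k (s : Nary k) → T (tautology k s) → Universally k s
tauto zero    (rs / p ⊢ cs) t   = valid-sound rs p cs t
tauto (suc k) s t b with tautology k (s true) in eq₁ | tautology k (s false) in eq₂
tauto (suc k) s t true  | true | true = tauto k (s true)  (subst T (≡-sym eq₁) tt)
tauto (suc k) s t false | true | true = tauto k (s false) (subst T (≡-sym eq₂) tt)

fewMisses : List Bool → ℕ → Bool
fewMisses bs k = sum (map miss bs) ≤ᵇ k

fin2 : (a b c : Fin 2) → a ≢ b → b ≢ c → a ≢ c → ⊥
fin2 zero       zero       c          p q r = p refl
fin2 zero       (suc zero) zero       p q r = r refl
fin2 zero       (suc zero) (suc zero) p q r = q refl
fin2 (suc zero) zero       zero       p q r = q refl
fin2 (suc zero) zero       (suc zero) p q r = r refl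
fin2 (suc zero) (suc zero) c          p q r = p refl

-- Locally bipartite graphs

module LocallyBipartiteCase (G : Graph) (lc : LocalColouring 2 G)
  (few-misses : ∀ vs k → 3 * length vs ≤ suc k * 7 → ∃ λ w → misses G w vs ≤ k) where

  private
    V : Set
    V = Fin (n G)

    _~_ : V → V → Set
    _~_ = Adj G

    infix 4 _~_

    κ : V → V → Fin 2
    κ = proj₁ lc

    κ-proper : ∀ {p u v} → p ~ u → p ~ v → u ~ v → κ p u ≢ κ p v
    κ-proper = proj₂ lc _ _ _

    ~sym : ∀ {u v} → u ~ v → v ~ u
    ~sym = Adj-sym G

    -- The implicit argument decides the arithmetic, with `7 = 3b + 1`; the Boolean form of the
    -- result matches `fewMisses`.
    locate : ∀ vs k → {True (3 * length vs ≤? suc k * 7)} → ∃ λ w → T (misses G w vs ≤ᵇ k)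
    locate vs k {le} = let w , few = few-misses vs k (toWitness le) in w , ≤⇒≤ᵇ few

  noK₄ : ∀ {a b c d} → a ~ b → a ~ c → b ~ c → a ~ d → b ~ d → c ~ d → ⊥
  noK₄ ab ac bc ad bd cd = fin2 _ _ _ (κ-proper ab ac bc) (κ-proper ac ad cd) (κ-proper ab ad bd)

  -- The rim of the wheel would be an odd cycle in the neighbourhood of `t`.
  noW₅ : ∀ {t a b c d e} → t ~ a → t ~ b → t ~ c → t ~ d → t ~ e →
    a ~ b → b ~ c → c ~ d → d ~ e → e ~ a → ⊥
  noW₅ {t} {a} {b} {c} {d} {e} ta tb tc td te ab bc cd de ea =
    odd (κ t a) (κ t b) (κ t c) (κ t d) (κ t e)
      (κ-proper ta tb ab) (κ-proper tb tc bc) (κ-proper tc td cd) (κ-proper td te de) (κ-proper te ta ea)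
    where
    odd : (a b c d e : Fin 2) → a ≢ b → b ≢ c → c ≢ d → d ≢ e → e ≢ a → ⊥
    odd a b c d e p q r s o with a ≟ c
    ... | no  a≢c  = fin2 a b c p q a≢c
    ... | yes refl with d ≟ a
    ...   | yes refl = r refl
    ...   | no  d≢a  = fin2 d e a s o d≢a

  Twin : V → V → Set
  Twin u v = ∃₂ λ f g → f ~ g × u ~ f × u ~ g × v ~ f × v ~ g

  Twin-sym : ∀ {u v} → Twin u v → Twin v u
  Twin-sym (f , g , fg , uf , ug , vf , vg) = f , g , fg , vf , vg , uf , ug

  Twin? : ∀ u v → Dec (Twin u v)
  Twin? u v = any? λ f → any? λ g →
    T? (E G f g) ×-dec T? (E G u f) ×-dec T? (E G u g) ×-dec T? (E G v f) ×-dec T? (E G v g)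

  -- Some `t` misses at most two of the seven. By `noK₄` it misses part of each of the four
  -- triangles, so it misses exactly one of `x`, `y` and one of `x′`, `y′`. The other five vertices
  -- form a 5-cycle in its neighbourhood, against `noW₅`.
  no-Moser-spindle : ∀ {u v w} → Twin u v → Twin v w → ¬ u ~ w
  no-Moser-spindle {u} {v} {w} (x , y , xy , ux , uy , vx , vy) (x′ , y′ , xy′ , vx′ , vy′ , wx′ , wy′) uw
    = let t , few = locate (u ∷ v ∷ w ∷ x ∷ y ∷ x′ ∷ y′ ∷ []) 2 in tauto 7 (λ u v w x y x′ y′ →
        (u ∷ x ∷ y ∷ []) ∷ (v ∷ x ∷ y ∷ []) ∷ (v ∷ x′ ∷ y′ ∷ []) ∷ (w ∷ x′ ∷ y′ ∷ []) ∷
        (u ∷ x ∷ v ∷ x′ ∷ w ∷ []) ∷ (u ∷ x ∷ v ∷ y′ ∷ w ∷ []) ∷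
        (u ∷ y ∷ v ∷ x′ ∷ w ∷ []) ∷ (u ∷ y ∷ v ∷ y′ ∷ w ∷ []) ∷ []
        / fewMisses (u ∷ v ∷ w ∷ x ∷ y ∷ x′ ∷ y′ ∷ []) 2 ⊢ []) tt
      (E G u t) (E G v t) (E G w t) (E G x t) (E G y t) (E G x′ t) (E G y′ t)
      (noK₄ ux uy xy) (noK₄ vx vy xy) (noK₄ vx′ vy′ xy′) (noK₄ wx′ wy′ xy′)
      (λ ut at vt bt wt → cycle ut at vt bt wt ux vx vx′ wx′)
      (λ ut at vt bt wt → cycle ut at vt bt wt ux vx vy′ wy′)
      (λ ut at vt bt wt → cycle ut at vt bt wt uy vy vx′ wx′)
      (λ ut at vt bt wt → cycle ut at vt bt wt uy vy vy′ wy′)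
      few
    where
    cycle : ∀ {t a b} → u ~ t → a ~ t → v ~ t → b ~ t → w ~ t → u ~ a → v ~ a → v ~ b → w ~ b → ⊥
    cycle ut at vt bt wt ua va vb wb =
      noW₅ (~sym ut) (~sym at) (~sym vt) (~sym bt) (~sym wt) ua (~sym va) vb (~sym wb) (~sym uw)

  Sparse : V → V → Set
  Sparse u v = ¬ Twin u v

  private
    sparse : ∀ {u v p w} → Sparse u v → u ~ p → v ~ p → u ~ w → v ~ w → p ~ w → ⊥
    sparse s up vp uw vw pw = s (_ , _ , pw , up , uw , vp , vw)

  record Triangle (x y z : V) : Set where
    constructor triangle
    field
      xy : x ~ y
      xz : x ~ z
      yz : y ~ z

  swap₁₂ : ∀ {x y z} → Triangle x y z → Triangle y x z
  swap₁₂ (triangle xy xz yz) = triangle (~sym xy) yz xz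

  swap₂₃ : ∀ {x y z} → Triangle x y z → Triangle x z y
  swap₂₃ (triangle xy xz yz) = triangle xz xy (~sym yz)

  record Exceptional (x y z e : V) : Set where
    constructor exceptional
    field
      ex : Sparse e x
      ey : Sparse e y
      ez : Sparse e z

  exc₁₂ : ∀ {x y z e} → Exceptional x y z e → Exceptional y x z e
  exc₁₂ (exceptional ex ey ez) = exceptional ey ex ez

  exc₂₃ : ∀ {x y z e} → Exceptional x y z e → Exceptional x z y e
  exc₂₃ (exceptional ex ey ez) = exceptional ex ez ey

  record Common (u v w p : V) : Set where
    constructor common
    field
      up : u ~ p
      vp : v ~ p
      wp : w ~ p

  -- With `x` counted twice, a vertex missing `x` sees everything else, including `e`, `y` and `p`,
  -- which `ey` forbids. A vertex seeing `x` would have to miss an end of every edge of the 5-cycle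
  -- `y z q e p`, so at least three vertices.
  exceptional-one-side : ∀ {x y z e p q} → Triangle x y z → Exceptional x y z e →
    Common e x y p → Common e x z q → ⊥
  exceptional-one-side {x} {y} {z} {e} {p} {q} (triangle xy xz yz) (exceptional ex ey ez)
    (common ep xp yp) (common eq xq zq) =
    let t , few = locate (p ∷ q ∷ e ∷ x ∷ x ∷ y ∷ z ∷ []) 2 in
    tauto 6 (λ p q e x y z →
        (x ∷ y ∷ z ∷ []) ∷ (x ∷ y ∷ p ∷ []) ∷ (x ∷ z ∷ q ∷ []) ∷
        (e ∷ x ∷ q ∷ []) ∷ (e ∷ x ∷ p ∷ []) ∷ (e ∷ y ∷ p ∷ []) ∷ (e ∷ z ∷ q ∷ []) ∷ []
        / fewMisses (p ∷ q ∷ e ∷ x ∷ x ∷ y ∷ z ∷ []) 2 ⊢ []) tt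
      (E G p t) (E G q t) (E G e t) (E G x t) (E G y t) (E G z t)
      (noK₄ xy xz yz) (noK₄ xy xp yp) (noK₄ xz xq zq)
      (sparse ex eq xq) (sparse ex ep xp) (sparse ey ep yp) (sparse ez eq zq)
      few

  -- Some vertex misses at most one of the four, and by `noK₄` the missed one belongs to the
  -- triangle.
  exists-side : ∀ {x y z} → Triangle x y z → ∀ e →
    ∃ (Common e x y) ⊎ ∃ (Common e x z) ⊎ ∃ (Common e y z)
  exists-side {x} {y} {z} (triangle xy xz yz) e =
    let t , few = locate (e ∷ x ∷ y ∷ z ∷ []) 1 in
    conclude t (tauto 4 (λ e x y z → (x ∷ y ∷ z ∷ []) ∷ []
        / fewMisses (e ∷ x ∷ y ∷ z ∷ []) 1 ⊢ (e ∷ x ∷ y ∷ []) ∷ (e ∷ x ∷ z ∷ []) ∷ (e ∷ y ∷ z ∷ []) ∷ []) tt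
      (E G e t) (E G x t) (E G y t) (E G z t) (noK₄ xy xz yz) few)
    where
    conclude : ∀ t → Disjunction ((E G e t ∷ E G x t ∷ E G y t ∷ []) ∷ (E G e t ∷ E G x t ∷ E G z t ∷ []) ∷
      (E G e t ∷ E G y t ∷ E G z t ∷ []) ∷ []) → ∃ (Common e x y) ⊎ ∃ (Common e x z) ⊎ ∃ (Common e y z)
    conclude t (inj₁ (a , b , c , _))               = inj₁ (t , common a b c)
    conclude t (inj₂ (inj₁ (a , b , c , _)))        = inj₂ (inj₁ (t , common a b c))
    conclude t (inj₂ (inj₂ (inj₁ (a , b , c , _)))) = inj₂ (inj₂ (t , common a b c))

  module _ {x y z : V} (tri : Triangle x y z) where
    open Triangle tri

    private
      none-xz : ∀ {e p t} → Exceptional x y z e → Common e x y p → e ~ t → x ~ t → z ~ t → ⊥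
      none-xz exc c et xt zt = exceptional-one-side tri exc c (common et xt zt)

      none-yz : ∀ {e p t} → Exceptional x y z e → Common e x y p → e ~ t → y ~ t → z ~ t → ⊥
      none-yz exc (common ep xp yp) et yt zt =
        exceptional-one-side (swap₁₂ tri) (exc₁₂ exc) (common ep yp xp) (common et yt zt)

    -- Of the weights 1, 1, 2, 2, 3 at most 3 is missed. Missing `x` or `y` while seeing the rest of
    -- the triangle would force missing `e` and `e′` too, a total of 4. So `z` is missed and nothing
    -- else.
    share-neighbour : ∀ {e e′ p p′} → Exceptional x y z e → Exceptional x y z e′ →
      Common e x y p → Common e′ x y p′ → ∃ λ q → Common e x y q × Common e′ x y q
    share-neighbour {e} {e′} exc exc′ c c′ =
      let t , few = locate (e ∷ e′ ∷ x ∷ x ∷ y ∷ y ∷ z ∷ z ∷ z ∷ []) 3 in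
      conclude t (tauto 5 (λ e e′ x y z →
          (x ∷ y ∷ z ∷ []) ∷ (e ∷ x ∷ z ∷ []) ∷ (e ∷ y ∷ z ∷ []) ∷ (e′ ∷ x ∷ z ∷ []) ∷ (e′ ∷ y ∷ z ∷ []) ∷ []
          / fewMisses (e ∷ e′ ∷ x ∷ x ∷ y ∷ y ∷ z ∷ z ∷ z ∷ []) 3 ⊢ (e ∷ e′ ∷ x ∷ y ∷ []) ∷ []) tt
        (E G e t) (E G e′ t) (E G x t) (E G y t) (E G z t)
        (noK₄ xy xz yz) (none-xz exc c) (none-yz exc c) (none-xz exc′ c′) (none-yz exc′ c′) few)
      where
      conclude : ∀ t → Disjunction ((E G e t ∷ E G e′ t ∷ E G x t ∷ E G y t ∷ []) ∷ []) →
        ∃ λ q → Common e x y q × Common e′ x y q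
      conclude t (inj₁ (et , et′ , xt , yt , _)) = t , common et xt yt , common et′ xt yt

    -- At most two of the seven are missed. If just one of them is in the triangle, two further
    -- misses are forced. If two are, the third triangle vertex is seen together with `e`, `p` or
    -- with `e′`, `p′`, which would make an exceptional vertex a twin.
    same-side : ∀ {e e′ p p′} → Exceptional x y z e → Exceptional x y z e′ →
      Common e x y p → Common e′ x z p′ → ⊥
    same-side {e} {e′} {p} {p′} exc exc′ c@(common ep xp yp) c′@(common ep′ xp′ zp′) =
      let t , few = locate (p ∷ e ∷ p′ ∷ e′ ∷ x ∷ y ∷ z ∷ []) 2 in
      tauto 7 (λ p e p′ e′ x y z →
          (x ∷ y ∷ z ∷ []) ∷ (x ∷ y ∷ p ∷ []) ∷ (x ∷ z ∷ p′ ∷ []) ∷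
          (e ∷ x ∷ z ∷ []) ∷ (e ∷ y ∷ z ∷ []) ∷ (e′ ∷ x ∷ y ∷ []) ∷ (e′ ∷ z ∷ y ∷ []) ∷
          (e ∷ x ∷ p ∷ []) ∷ (e ∷ y ∷ p ∷ []) ∷ (e′ ∷ z ∷ p′ ∷ []) ∷ []
          / fewMisses (p ∷ e ∷ p′ ∷ e′ ∷ x ∷ y ∷ z ∷ []) 2 ⊢ []) tt
        (E G p t) (E G e t) (E G p′ t) (E G e′ t) (E G x t) (E G y t) (E G z t)
        (noK₄ xy xz yz) (noK₄ xy xp yp) (noK₄ xz xp′ zp′)
        (none-xz exc c) (none-yz exc c)
        (λ et xt yt → exceptional-one-side (swap₂₃ tri) (exc₂₃ exc′) c′ (common et xt yt))
        (λ et zt yt → exceptional-one-side (swap₁₂ (swap₂₃ tri)) (exc₁₂ (exc₂₃ exc′))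
                        (common ep′ zp′ xp′) (common et zt yt))
        (sparse (Exceptional.ex exc) ep xp) (sparse (Exceptional.ey exc) ep yp)
        (sparse (Exceptional.ez exc′) ep′ zp′) few

    -- The four sets N(x), N(y), N(q), N(e) cannot be disjoint inside N(p).
    forced-twin : ∀ {e p q} → Sparse e x → Sparse e y → Common e x y p → p ~ q → e ~ q →
      κ p e ≡ κ p x → Twin q y
    forced-twin {e} {p} {q} ex ey (common ep xp yp) pq eq κ≡ =
      -- Weight three on `p` forces `p ~ t`. Two of `x`, `y`, `q`, `e` are then seen, and one of
      -- them is `q`.
      let t , few = locate (x ∷ y ∷ q ∷ e ∷ p ∷ p ∷ p ∷ []) 2 in
      conclude t (tauto 5 (λ x y q e p →
          (p ∷ x ∷ y ∷ []) ∷ (p ∷ q ∷ e ∷ []) ∷ (e ∷ x ∷ p ∷ []) ∷ (e ∷ y ∷ p ∷ []) ∷ []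
          / fewMisses (x ∷ y ∷ q ∷ e ∷ p ∷ p ∷ p ∷ []) 2 ⊢ (p ∷ q ∷ x ∷ []) ∷ (p ∷ q ∷ y ∷ []) ∷ []) tt
        (E G x t) (E G y t) (E G q t) (E G e t) (E G p t)
        (noK₄ (~sym xp) (~sym yp) xy) (noK₄ pq (~sym ep) (~sym eq)) (sparse ex ep xp) (sparse ey ep yp) few)
      where
      conclude : ∀ t → Disjunction ((E G p t ∷ E G q t ∷ E G x t ∷ []) ∷ (E G p t ∷ E G q t ∷ E G y t ∷ []) ∷ []) →
        Twin q y
      -- If `t` saw both `q` and `x`, then `t`, `q` and `e` would need three colours under `κ p`, as
      -- `e` has the colour of `x`.
      conclude t (inj₁ (pt , qt , xt , _)) = ⊥-elim (fin2 (κ p t) (κ p q) (κ p e)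
        (κ-proper pt pq (~sym qt)) (κ-proper pq (~sym ep) (~sym eq))
        (subst (κ p t ≢_) (≡-sym κ≡) (κ-proper pt (~sym xp) (~sym xt))))
      conclude t (inj₂ (inj₁ (pt , qt , yt , _))) = p , t , pt , ~sym pq , qt , yp , yt

  -- If `κ p` gives `e` the colour of `x` and `κ p′` that of `y`, then by `forced-twin` a common
  -- neighbour of `e`, `p`, `p′` is a twin of both `y` and `x`. As `x ~ y`, this is a Moser spindle.
  colour-independent : ∀ {x y z e p p′} → Triangle x y z → Sparse e x → Sparse e y →
    Common e x y p → Common e x y p′ → κ p e ≡ κ p x → κ p′ e ≡ κ p′ x
  colour-independent {x} {y} {z} {e} {p} {p′} tri ex ey c@(common ep xp yp) c′@(common ep′ xp′ yp′) κ≡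
    with κ p′ e ≟ κ p′ x
  ... | yes κ≡′ = κ≡′
  ... | no  κ≢  =
    -- Missing `e` or `p` exhausts the weight, and `t` sees `x`, `y` and one of `p`, `p′`, against
    -- `noK₄`. Otherwise missing `p′` would force missing both `x` and `y`.
    let t , few = locate (e ∷ e ∷ p ∷ p ∷ p′ ∷ x ∷ y ∷ []) 2 in
    ⊥-elim (conclude t (tauto 5 (λ e p p′ x y →
        (x ∷ y ∷ p ∷ []) ∷ (x ∷ y ∷ p′ ∷ []) ∷ (e ∷ x ∷ p ∷ []) ∷ (e ∷ x ∷ p′ ∷ []) ∷
        (e ∷ y ∷ p ∷ []) ∷ (e ∷ y ∷ p′ ∷ []) ∷ []
        / fewMisses (e ∷ e ∷ p ∷ p ∷ p′ ∷ x ∷ y ∷ []) 2 ⊢ (e ∷ p ∷ p′ ∷ []) ∷ []) tt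
      (E G e t) (E G p t) (E G p′ t) (E G x t) (E G y t)
      (noK₄ xy xp yp) (noK₄ xy xp′ yp′) (sparse ex ep xp) (sparse ex ep′ xp′)
      (sparse ey ep yp) (sparse ey ep′ yp′) few))
    where
    open Triangle tri using (xy)
    κ≡y : κ p′ e ≡ κ p′ y
    κ≡y with κ p′ e ≟ κ p′ y
    ... | yes eq = eq
    ... | no  ne = ⊥-elim (fin2 _ _ _ κ≢ (κ-proper (~sym xp′) (~sym yp′) xy) ne)
    conclude : ∀ t → Disjunction ((E G e t ∷ E G p t ∷ E G p′ t ∷ []) ∷ []) → ⊥
    conclude t (inj₁ (et , pt , pt′ , _)) = no-Moser-spindle
      (Twin-sym (forced-twin (swap₁₂ tri) ey ex (common ep′ yp′ xp′) pt′ et κ≡y))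
      (forced-twin tri ex ey c pt et κ≡) xy

  -- Given a common neighbour `w` of `v` and `e`, averaging yields `t` that sees `e`, `x`, `y` and
  -- one of `w`, `v`. In the first case `t` is a twin of `v` and adjacent to `x`; in the second
  -- `forced-twin` makes `v` a twin of `y`. Both give Moser spindles, as `v` is a twin of `x`.
  twin-not-adjacent : ∀ {x y z v e p} → Triangle x y z → Exceptional x y z e → Common e x y p →
    κ p e ≡ κ p x → Twin v x → ¬ v ~ e
  twin-not-adjacent {x} {y} {z} {v} {e} {p} tri exc c@(common ep xp yp) κ≡ vx ve =
    let w , near = locate (v ∷ e ∷ []) 0 in
    case tauto 2 (λ v e → [] / fewMisses (v ∷ e ∷ []) 0 ⊢ (v ∷ e ∷ []) ∷ []) tt (E G v w) (E G e w) near
    of λ { (inj₁ (vw , ew , _)) →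
      let t , few = locate (w ∷ e ∷ e ∷ v ∷ x ∷ y ∷ z ∷ []) 2 in
      case tauto 6 (λ w e v x y z →
          (x ∷ y ∷ z ∷ []) ∷ (v ∷ e ∷ w ∷ []) ∷ (e ∷ x ∷ z ∷ []) ∷ (e ∷ y ∷ z ∷ []) ∷ []
          / fewMisses (w ∷ e ∷ e ∷ v ∷ x ∷ y ∷ z ∷ []) 2 ⊢
          (e ∷ x ∷ y ∷ w ∷ []) ∷ (e ∷ x ∷ y ∷ v ∷ []) ∷ []) tt
        (E G w t) (E G e t) (E G v t) (E G x t) (E G y t) (E G z t)
        (noK₄ xy xz yz) (noK₄ ve vw ew)
        (λ et xt zt → exceptional-one-side tri exc c (common et xt zt))
        (λ et yt zt → exceptional-one-side (swap₁₂ tri) (exc₁₂ exc) (common ep yp xp) (common et yt zt)) few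
      of λ { (inj₁ (et , xt , yt , wt , _)) →
               no-Moser-spindle (w , e , ~sym ew , ~sym wt , ~sym et , vw , ve) vx (~sym xt)
           ; (inj₂ (inj₁ (et , xt , yt , vt , _))) →
               no-Moser-spindle (Twin-sym vx)
                 (forced-twin tri ex ey (common et xt yt) (~sym vt) (~sym ve)
                   (colour-independent tri ex ey c (common et xt yt) κ≡)) xy } }
    where
    open Triangle tri
    open Exceptional exc

  -- The colour class of x: the twins of x, together with the vertices that are no twin of x, y or z
  -- but have the colour of x in the neighbourhood of a common neighbour with x and one of y, z.
  data Coloured (x y z v : V) : Set where
    twin  : Twin v x → Coloured x y z v
    via-y : ∀ {p} → Exceptional x y z v → Common v x y p → κ p v ≡ κ p x → Coloured x y z v
    via-z : ∀ {p} → Exceptional x y z v → Common v x z p → κ p v ≡ κ p x → Coloured x y z v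

  swapColoured : ∀ {x y z v} → Coloured x y z v → Coloured x z y v
  swapColoured (twin t)        = twin t
  swapColoured (via-y exc c k) = via-z (exc₂₃ exc) c k
  swapColoured (via-z exc c k) = via-y (exc₂₃ exc) c k

  -- At a common neighbour of `u`, `v`, `x` and `y`, both `u` and `v` get the colour of `x`.
  via-y-independent : ∀ {x y z u v p q} → Triangle x y z → u ~ v →
    Exceptional x y z u → Common u x y p → κ p u ≡ κ p x →
    Exceptional x y z v → Common v x y q → κ q v ≡ κ q x → ⊥
  via-y-independent tri uv exc c κ≡ exc′ c′ κ≡′ =
    let q , d@(common uq _ _) , d′@(common vq _ _) = share-neighbour tri exc exc′ c c′
        open Exceptional
    in κ-proper (~sym uq) (~sym vq) uv (trans
         (colour-independent tri (ex exc) (ey exc) c d κ≡)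
         (≡-sym (colour-independent tri (ex exc′) (ey exc′) c′ d′ κ≡′)))

  Coloured-independent : ∀ {x y z u v} → Triangle x y z → Coloured x y z u → Coloured x y z v → ¬ u ~ v
  Coloured-independent tri (twin s) (twin t) uv = no-Moser-spindle s (Twin-sym t) uv
  Coloured-independent tri (twin s) (via-y exc c k) uv = twin-not-adjacent tri exc c k s uv
  Coloured-independent tri (twin s) (via-z exc c k) uv = twin-not-adjacent (swap₂₃ tri) (exc₂₃ exc) c k s uv
  Coloured-independent tri (via-y exc c k) (twin t) uv = twin-not-adjacent tri exc c k t (~sym uv)
  Coloured-independent tri (via-z exc c k) (twin t) uv = twin-not-adjacent (swap₂₃ tri) (exc₂₃ exc) c k t (~sym uv)
  Coloured-independent tri (via-y exc c k) (via-y exc′ c′ k′) uv = via-y-independent tri uv exc c k exc′ c′ k′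
  Coloured-independent tri (via-z exc c k) (via-z exc′ c′ k′) uv =
    via-y-independent (swap₂₃ tri) uv (exc₂₃ exc) c k (exc₂₃ exc′) c′ k′
  Coloured-independent tri (via-y exc c k) (via-z exc′ c′ k′) uv = same-side tri exc exc′ c c′
  Coloured-independent tri (via-z exc c k) (via-y exc′ c′ k′) uv = same-side tri exc′ exc c′ c

  private
    side-colour : ∀ {x y z e p} → Triangle x y z → Exceptional x y z e → Common e x y p →
      Coloured x y z e ⊎ Coloured y x z e
    side-colour {x} {y} {z} {e} {p} (triangle xy _ _) exc c@(common ep xp yp) with κ p e ≟ κ p x | κ p e ≟ κ p y
    ... | yes κ≡ | _      = inj₁ (via-y exc c κ≡)
    ... | no  _  | yes κ≡ = inj₂ (via-y (exc₁₂ exc) (common ep yp xp) κ≡)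
    ... | no  κ≢ | no κ≢′ = ⊥-elim (fin2 _ _ _ κ≢ (κ-proper (~sym xp) (~sym yp) xy) κ≢′)

  some-colour : ∀ {x y z} → Triangle x y z → ∀ v → Coloured x y z v ⊎ Coloured y x z v ⊎ Coloured z x y v
  some-colour {x} {y} {z} tri v with Twin? v x | Twin? v y | Twin? v z
  ... | yes t | _     | _     = inj₁ (twin t)
  ... | no  _ | yes t | _     = inj₂ (inj₁ (twin t))
  ... | no  _ | no  _ | yes t = inj₂ (inj₂ (twin t))
  ... | no vx | no vy | no vz with exists-side tri v
  ...   | inj₁ (p , c) with side-colour tri (exceptional vx vy vz) c
  ...     | inj₁ cx = inj₁ cx
  ...     | inj₂ cy = inj₂ (inj₁ cy)
  some-colour {x} {y} {z} tri v | no vx | no vy | no vz | inj₂ (inj₁ (p , c))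
    with side-colour (swap₂₃ tri) (exceptional vx vz vy) c
  ... | inj₁ cx = inj₁ (swapColoured cx)
  ... | inj₂ cz = inj₂ (inj₂ cz)
  some-colour {x} {y} {z} tri v | no vx | no vy | no vz | inj₂ (inj₂ (p , c))
    with side-colour (swap₂₃ (swap₁₂ tri)) (exceptional vy vz vx) c
  ... | inj₁ cy = inj₂ (inj₁ (swapColoured cy))
  ... | inj₂ cz = inj₂ (inj₂ (swapColoured cz))

  exists-triangle : V → ∃ λ x → ∃₂ λ y z → Triangle x y z
  exists-triangle x =
    let y , near  = locate (x ∷ []) 0
        z , near′ = locate (x ∷ y ∷ []) 0
    in case tauto 1 (λ x → [] / fewMisses (x ∷ []) 0 ⊢ (x ∷ []) ∷ []) tt (E G x y) near
    of λ { (inj₁ (xy , _)) →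
      case tauto 2 (λ x y → [] / fewMisses (x ∷ y ∷ []) 0 ⊢ (x ∷ y ∷ []) ∷ []) tt (E G x z) (E G y z) near′
      of λ { (inj₁ (xz , yz , _)) → x , y , z , triangle xy xz yz } }

  private
    colouring : ∀ {x y z} → Triangle x y z → Colourable 3 G
    colouring {x} {y} {z} tri = (λ v → colour (some-colour tri v)) , λ u v uv → proper (some-colour tri u) (some-colour tri v) uv
      where
      colour : ∀ {v} → Coloured x y z v ⊎ Coloured y x z v ⊎ Coloured z x y v → Fin 3
      colour (inj₁ _)        = zero
      colour (inj₂ (inj₁ _)) = suc zero
      colour (inj₂ (inj₂ _)) = suc (suc zero)
      proper : ∀ {u v} (cu : Coloured x y z u ⊎ Coloured y x z u ⊎ Coloured z x y u)
        (cv : Coloured x y z v ⊎ Coloured y x z v ⊎ Coloured z x y v) → u ~ v → colour cu ≢ colour cv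
      proper (inj₁ a)        (inj₁ b)        uv eq = Coloured-independent tri a b uv
      proper (inj₂ (inj₁ a)) (inj₂ (inj₁ b)) uv eq = Coloured-independent (swap₁₂ tri) a b uv
      proper (inj₂ (inj₂ a)) (inj₂ (inj₂ b)) uv eq = Coloured-independent (swap₁₂ (swap₂₃ tri)) a b uv
      proper (inj₁ _)        (inj₂ (inj₁ _)) uv ()
      proper (inj₁ _)        (inj₂ (inj₂ _)) uv ()
      proper (inj₂ (inj₁ _)) (inj₁ _)        uv ()
      proper (inj₂ (inj₁ _)) (inj₂ (inj₂ _)) uv ()
      proper (inj₂ (inj₂ _)) (inj₁ _)        uv ()
      proper (inj₂ (inj₂ _)) (inj₂ (inj₁ _)) uv ()

  3-colourable : V → Colourable 3 G
  3-colourable v = let _ , _ , _ , tri = exists-triangle v in colouring tri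

-- Locally b-colourable graphs for b ≥ 3

misses-++ : ∀ G w xs ys → misses G w (xs ++ ys) ≡ misses G w xs + misses G w ys
misses-++ G w []       ys = refl
misses-++ G w (x ∷ xs) ys = trans (cong (miss (E G x w) +_) (misses-++ G w xs ys)) (≡-sym (+-assoc (miss (E G x w)) _ _))

length-concat-replicate : ∀ {A : Set} k (xs : List A) → length (concat (replicate k xs)) ≡ k * length xs
length-concat-replicate zero    xs = refl
length-concat-replicate (suc k) xs = trans (length-++ xs) (cong (length xs +_) (length-concat-replicate k xs))

misses-replicate : ∀ G w k xs → misses G w (concat (replicate k xs)) ≡ k * misses G w xs
misses-replicate G w zero    xs = refl
misses-replicate G w (suc k) xs =
  trans (misses-++ G w xs _) (cong (misses G w xs +_) (misses-replicate G w k xs))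

misses≡0⇒adjacent : ∀ G {w} vs → misses G w vs ≤ 0 → All (λ v → Adj G v w) vs
misses≡0⇒adjacent G []       le = []
misses≡0⇒adjacent G {w} (v ∷ vs) le with E G v w in eq
... | true = subst T (≡-sym eq) tt ∷ misses≡0⇒adjacent G vs le

nonadjacent⇒miss : ∀ G {v w} → ¬ Adj G v w → 1 ≤ miss (E G v w)
nonadjacent⇒miss G {v} {w} na with E G v w
... | true  = ⊥-elim (na tt)
... | false = ≤-refl

misses-some : ∀ G {w k} (c : Fin k → Fin (n G)) i → ¬ Adj G (c i) w → 1 ≤ misses G w (tabulate c)
misses-some G c zero    na = ≤-trans (nonadjacent⇒miss G na) (m≤m+n _ _)
misses-some G c (suc i) na = ≤-trans (misses-some G (c ∘ suc) i na) (m≤n+m _ _)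

misses-every : ∀ G {w k} (c : Fin k → Fin (n G)) → (∀ i → ¬ Adj G (c i) w) → k ≤ misses G w (tabulate c)
misses-every G {k = zero}  c na = z≤n
misses-every G {k = suc k} c na = +-mono-≤ (nonadjacent⇒miss G (na zero)) (misses-every G (c ∘ suc) (na ∘ suc))

-- When no larger clique exists, `K i` is the one vertex of `K` that `w` misses.
Near : (G : Graph) {k : ℕ} → (Fin k → Fin (n G)) → Fin (n G) → Fin k → Set
Near G K w i = ∀ j → j ≢ i → Adj G (K j) w

all-or-near : ∀ G {w k} (K : Fin k → Fin (n G)) → misses G w (tabulate K) ≤ 1 →
  (∀ i → Adj G (K i) w) ⊎ ∃ (Near G K w)
all-or-near G {k = zero}  K le = inj₁ λ ()
all-or-near G {w} {suc k} K le with E G (K zero) w in eq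
all-or-near G {w} {suc k} K (s≤s le) | false =
  inj₂ (zero , λ { zero ne → ⊥-elim (ne refl) ; (suc j) ne → tabulate⁻ (misses≡0⇒adjacent G _ le) j })
all-or-near G {w} {suc k} K le | true with all-or-near G (K ∘ suc) le
... | inj₁ ad       = inj₁ λ { zero → subst T (≡-sym eq) tt ; (suc i) → ad i }
... | inj₂ (i , nr) = inj₂ (suc i , λ { zero ne → subst T (≡-sym eq) tt ; (suc j) ne → nr j (ne ∘ cong suc) })

not-all-adjacent : ∀ G {k} (K : Fin k → Fin (n G)) → Clique G K → CliqueFree (suc k) G →
  ∀ {w} → ¬ (∀ i → Adj G (K i) w)
not-all-adjacent G K cl free {w} ad = free (w ◂ K) (clique-◂ G w K cl (λ i → Adj-sym G (ad i)))

1≤misses-clique : ∀ G {k} (K : Fin k → Fin (n G)) → Clique G K → CliqueFree (suc k) G →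
  ∀ w → 1 ≤ misses G w (tabulate K)
1≤misses-clique G K cl free w with 1 ≤? misses G w (tabulate K)
... | yes le = le
... | no  nl = ⊥-elim (not-all-adjacent G K cl free (tabulate⁻ (misses≡0⇒adjacent G _ (≤-pred (≰⇒> nl)))))

-- Every vertex misses at least one vertex of K, so a vertex with at most one miss has its miss in K.
one-miss⇒near : ∀ G {w k} (K : Fin k → Fin (n G)) → Clique G K → CliqueFree (suc k) G →
  ∀ vs → misses G w (vs ++ tabulate K) ≤ 1 → All (λ v → Adj G v w) vs × ∃ (Near G K w)
one-miss⇒near G {w} K cl free vs le
  with all-or-near G K (≤-trans (m≤n+m _ (misses G w vs)) (≤-trans (≤-reflexive (≡-sym (misses-++ G w vs (tabulate K)))) le))
... | inj₁ ad = ⊥-elim (not-all-adjacent G K cl free ad)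
... | inj₂ nr = misses≡0⇒adjacent G vs (+-cancelʳ-≤ 1 _ _ (≤-trans
    (+-monoʳ-≤ (misses G w vs) (1≤misses-clique G K cl free w))
    (≤-trans (≤-reflexive (≡-sym (misses-++ G w vs (tabulate K)))) le))) , nr

exists-near : ∀ {m b} G → Dense m b G → ∀ {k} (K : Fin k → Fin (n G)) → Clique G K → CliqueFree (suc k) G →
  ∀ vs → 3 * (length vs + k) ≤ 2 * (3 * b + 1) → ∃ λ w → All (λ v → Adj G v w) vs × ∃ (Near G K w)
exists-near {b = b} G d {k} K cl free vs le =
  let w , few = find G d (vs ++ tabulate K) 1 (subst (λ l → 3 * l ≤ 2 * (3 * b + 1)) (≡-sym len) le)
  in w , one-miss⇒near G K cl free vs few
  where
  len : length (vs ++ tabulate K) ≡ length vs + k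
  len = trans (length-++ vs) (cong (length vs +_) (length-tabulate K))

-- Adjacent `u` and `w` could replace `K i` and enlarge the clique by one.
near-independent : ∀ G {k} (K : Fin (suc k) → Fin (n G)) → Clique G K → CliqueFree (suc (suc k)) G →
  ∀ {u w i} → Near G K u i → Near G K w i → ¬ Adj G u w
near-independent G K cl free {u} {w} {i} nu nw uw = free (u ◂ (w ◂ (K ∘ punchIn i)))
  (clique-◂ G u _ (clique-◂ G w _ (clique-∘ G K (punchIn i) (punchIn-injective i _ _) cl) (ad w nw))
    λ { zero → uw ; (suc j) → ad u nu j })
  where
  ad : ∀ w → Near G K w i → ∀ j → Adj G w (K (punchIn i j))
  ad w nw j = Adj-sym G (nw _ (punchInᵢ≢i i j))

module Restrict (G : Graph) {k : ℕ} (K : Fin (suc k) → Fin (n G)) (p : Fin (n G)) (i : Fin (suc k))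
                (near : Near G K p i) where
  open Link G p

  adj : ∀ j → Adj G p (K (punchIn i j))
  adj j = Adj-sym G (near _ (punchInᵢ≢i i j))

  K′ : Fin k → Fin (n (link G p))
  K′ j = ι⁻¹ (adj j)

  ι-K′ : ∀ j → ι (K′ j) ≡ K (punchIn i j)
  ι-K′ j = ι-ι⁻¹ (adj j)

  K′-clique : Clique G K → Clique (link G p) K′
  K′-clique cl a b ne = subst₂ (Adj G) (≡-sym (ι-K′ a)) (≡-sym (ι-K′ b))
    (cl _ _ (ne ∘ punchIn-injective i a b))

-- Colours forced by a clique

Proper : (G : Graph) {c : ℕ} → (Fin (n G) → Fin c) → Set
Proper G κ = ∀ u v → Adj G u v → κ u ≢ κ v

Palette : (G : Graph) {c k : ℕ} → (Fin k → Fin (n G)) → (Fin (n G) → Fin c) → Set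
Palette G K κ = ∀ w → ∃ λ j → κ w ≡ κ (K j)

-- The index `j` is fixed before the colouring; this is what allows two different colourings to be
-- compared.
ForcedColour : ℕ → (G : Graph) {k : ℕ} → (Fin k → Fin (n G)) → Fin (n G) → Fin k → Set
ForcedColour c G K v j = (κ : Fin (n G) → Fin c) → Proper G κ → Palette G K κ → κ v ≡ κ (K j)

two-colours : ∀ {c} G (K : Fin 2 → Fin (n G)) (κ : Fin (n G) → Fin c) → Palette G K κ →
  ∀ {u v w} → κ u ≢ κ v → κ v ≢ κ w → κ u ≡ κ w
two-colours G K κ pal {u} {v} {w} ne ne′ with pal u | pal v | pal w
... | zero     , a | zero     , b | _          , c = ⊥-elim (ne (trans a (≡-sym b)))
... | suc zero , a | suc zero , b | _          , c = ⊥-elim (ne (trans a (≡-sym b)))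
... | _        , a | zero     , b | zero     , c = ⊥-elim (ne′ (trans b (≡-sym c)))
... | _        , a | suc zero , b | suc zero , c = ⊥-elim (ne′ (trans b (≡-sym c)))
... | zero     , a | suc zero , b | zero     , c = trans a (≡-sym c)
... | suc zero , a | zero     , b | suc zero , c = trans a (≡-sym c)

-- Let `q` be a neighbour of `v`. Some `t` misses at most two of `v`, `q`, `x`, `y`; without
-- triangles it sees exactly one end of each of the two edges. The resulting walk from `v` through
-- `t` to `K` has length 2 or 3, and its parity decides the colour of `v`.
forced-colour-base : ∀ c {m} G → Dense m 1 G → CliqueFree 3 G → (K : Fin 2 → Fin (n G)) → Clique G K →
  ∀ v → ∃ (ForcedColour c G K v)
forced-colour-base c {m} G d free K cl v = neighbour (find G d (v ∷ []) 0 (n≤1+n 3))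
  where
  x = K zero
  y = K (suc zero)
  xy : Adj G x y
  xy = cl _ _ λ ()
  noK₃ : ∀ {a b t} → Adj G a b → Adj G a t → Adj G b t → ⊥
  noK₃ {a} {b} {t} ab at bt = free (a ◂ (b ◂ λ _ → t))
    (clique-◂ G a _ (clique-◂ G b (λ _ → t) (λ { zero zero ne → ⊥-elim (ne refl) }) λ _ → bt)
      λ { zero → ab ; (suc _) → at })
  conclude : ∀ {q} → Adj G v q → ∀ t → Disjunction ((E G v t ∷ E G x t ∷ []) ∷ (E G v t ∷ E G y t ∷ []) ∷
    (E G q t ∷ E G x t ∷ []) ∷ (E G q t ∷ E G y t ∷ []) ∷ []) → ∃ (ForcedColour c G K v)
  conclude vq t (inj₁ (vt , xt , _)) = zero , λ κ pr pal →
    two-colours G K κ pal (pr _ _ vt) (pr _ _ (Adj-sym G xt))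
  conclude vq t (inj₂ (inj₁ (vt , yt , _))) = suc zero , λ κ pr pal →
    two-colours G K κ pal (pr _ _ vt) (pr _ _ (Adj-sym G yt))
  conclude vq t (inj₂ (inj₂ (inj₁ (qt , xt , _)))) = suc zero , λ κ pr pal →
    two-colours G K κ pal (pr _ _ vq) (pr _ _ xy ∘ trans (≡-sym (two-colours G K κ pal (pr _ _ qt) (pr _ _ (Adj-sym G xt)))))
  conclude vq t (inj₂ (inj₂ (inj₂ (inj₁ (qt , yt , _))))) = zero , λ κ pr pal →
    two-colours G K κ pal (pr _ _ vq) (pr _ _ (Adj-sym G xy) ∘ trans (≡-sym (two-colours G K κ pal (pr _ _ qt) (pr _ _ (Adj-sym G yt)))))

  second : ∀ {q} → Adj G v q → (∃ λ t → misses G t (v ∷ q ∷ x ∷ y ∷ []) ≤ 2) → ∃ (ForcedColour c G K v)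
  second {q} vq (t , few) = conclude vq t (tauto 4 (λ v q x y →
      (v ∷ q ∷ []) ∷ (x ∷ y ∷ []) ∷ []
      / fewMisses (v ∷ q ∷ x ∷ y ∷ []) 2 ⊢ (v ∷ x ∷ []) ∷ (v ∷ y ∷ []) ∷ (q ∷ x ∷ []) ∷ (q ∷ y ∷ []) ∷ []) tt
    (E G v t) (E G q t) (E G x t) (E G y t) (noK₃ vq) (noK₃ xy) (≤⇒≤ᵇ few))
  neighbour : (∃ λ q → misses G q (v ∷ []) ≤ 0) → ∃ (ForcedColour c G K v)
  neighbour (q , few) with vq ∷ [] ← misses≡0⇒adjacent G (v ∷ []) few =
    second vq (find G d (v ∷ q ∷ x ∷ y ∷ []) 2 ≤-refl)

-- All other colours on `K` occur at neighbours of `p`.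
near-colour : ∀ {c} G {k} (K : Fin k → Fin (n G)) (κ : Fin (n G) → Fin c) → Proper G κ → Palette G K κ →
  ∀ {p i} → Near G K p i → κ p ≡ κ (K i)
near-colour G K κ pr pal {p} {i} near with pal p
... | j , eq with j ≟ i
...   | yes refl = eq
...   | no  j≢i  = ⊥-elim (pr _ _ (near j j≢i) (≡-sym eq))

-- Induction through the link of a neighbour `p` of `v` that misses only `K i`: the rest of `K` lies
-- in that link.
forced-colour : ∀ c b {m} G → Dense m (suc b) G → CliqueFree (3 + b) G → (K : Fin (2 + b) → Fin (n G)) →
  Clique G K → ∀ v → ∃ (ForcedColour c G K v)
forced-colour c zero    G d free K cl v = forced-colour-base c G d free K cl v
forced-colour c (suc b) G d free K cl v = through (exists-near G d K cl free (v ∷ []) le)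
  where
  le : 3 * (1 + (3 + b)) ≤ 2 * (3 * (2 + b) + 1)
  le = ≤-trans (m≤m+n _ (2 + 3 * b)) (≤-reflexive (solve 1 (λ b →
    con 3 :* (con 1 :+ (con 3 :+ b)) :+ (con 2 :+ con 3 :* b) :=
    con 2 :* (con 3 :* (con 2 :+ b) :+ con 1)) refl b))
    where open +-*-Solver
  via : ∀ p → Adj G p v → ∀ i → Near G K p i → ∃ (ForcedColour c G K v)
  via p pv i near
    with j , forced ← forced-colour c b (link G p) (link-dense G p d) (link-cliqueFree G p free)
                        (Restrict.K′ G K p i near) (Restrict.K′-clique G K p i near cl) (Link.ι⁻¹ G p pv)
    = punchIn i j , λ κ pr pal →
        trans (≡-sym (cong κ (ι-ι⁻¹ pv)))
          (trans (forced (κ ∘ ι) (λ u w → pr (ι u) (ι w)) (palette κ pr pal)) (cong κ (ι-K′ j)))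
    where
    open Link G p
    open Restrict G K p i near
    palette : (κ : Fin (n G) → Fin c) → Proper G κ → Palette G K κ → Palette (link G p) K′ (κ ∘ ι)
    palette κ pr pal w with pal (ι w)
    ... | j , eq with i ≟ j
    -- `p` has the colour of `K i`, so its neighbour `w` does not.
    ...   | yes refl = ⊥-elim (pr _ _ (ι-adj w) (trans (near-colour G K κ pr pal near) (≡-sym eq)))
    ...   | no  i≢j  = punchOut i≢j , trans eq (cong κ (≡-sym (trans (ι-K′ _) (cong K (punchIn-punchOut i≢j)))))
  through : (∃ λ p → All (λ u → Adj G u p) (v ∷ []) × ∃ (Near G K p)) → ∃ (ForcedColour c G K v)
  through (p , vp ∷ [] , i , near) = via p (Adj-sym G vp) i near

injective⇒surjective : ∀ {b} (f : Fin b → Fin b) → (∀ {i j} → f i ≡ f j → i ≡ j) → ∀ y → ∃ λ x → f x ≡ y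
injective⇒surjective f inj y with any? (λ x → f x ≟ y)
... | yes found = found
... | no  none  = ⊥-elim (<-irrefl refl (injective⇒≤ {f = y ◂ f} inj′))
  where
  inj′ : ∀ {i j} → (y ◂ f) i ≡ (y ◂ f) j → i ≡ j
  inj′ {zero}  {zero}  eq = refl
  inj′ {zero}  {suc j} eq = ⊥-elim (none (j , ≡-sym eq))
  inj′ {suc i} {zero}  eq = ⊥-elim (none (i , eq))
  inj′ {suc i} {suc j} eq = cong suc (inj eq)

-- Any `b` vertices have a common neighbour.
exists-clique : ∀ {m b} G → Dense m b G → ∀ k → k ≤ suc b → ∃ λ (K : Fin k → Fin (n G)) → Clique G K
exists-clique G d zero    le = (λ ()) , λ ()
exists-clique {b = b} G d (suc k) (s≤s le) = extend (exists-clique G d k (m≤n⇒m≤1+n le))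
  where
  extend : (∃ λ (K : Fin k → Fin (n G)) → Clique G K) → ∃ λ (K : Fin (suc k) → Fin (n G)) → Clique G K
  extend (K , cl) =
    let w , few = find G d (tabulate K) 0 (begin
          3 * length (tabulate K) ≡⟨ cong (3 *_) (length-tabulate K) ⟩
          3 * k                   ≤⟨ *-monoʳ-≤ 3 le ⟩
          3 * b                   ≤⟨ m≤m+n (3 * b) 1 ⟩
          3 * b + 1               ≡⟨ *-identityˡ (3 * b + 1) ⟨
          1 * (3 * b + 1)         ∎)
    in w ◂ K , clique-◂ G w K cl (λ i → Adj-sym G (tabulate⁻ (misses≡0⇒adjacent G _ few) i))
    where open ≤-Reasoning

-- `ForcedColour` in the link of `q` within the link of `p`, restated for vertices of `G`; `i` and
-- `i′` are the indices missed by `p` and `q`.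
ForcedOnCommon : ℕ → (G : Graph) {k : ℕ} → (Fin k → Fin (n G)) → (p q v : Fin (n G)) → (i i′ J : Fin k) → Set
ForcedOnCommon c G K p q v i i′ J = J ≢ i × J ≢ i′ × ((χ : Fin (n G) → Fin c) →
  (∀ u w → Adj G p u → Adj G q u → Adj G p w → Adj G q w → Adj G u w → χ u ≢ χ w) →
  (∀ w → Adj G p w → Adj G q w → ∃ λ j → j ≢ i × j ≢ i′ × χ w ≡ χ (K j)) →
  χ v ≡ χ (K J))

module CommonLink (G : Graph) {k : ℕ} (K : Fin (2 + k) → Fin (n G)) (cl : Clique G K) {p q v : Fin (n G)}
  (pq : Adj G p q) (pv : Adj G p v) (qv : Adj G q v) {i i′ : Fin (2 + k)}
  (near : Near G K p i) (near′ : Near G K q i′) (i≢i′ : i ≢ i′) where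

  private
    module L = Link G p
    module R = Restrict G K p i near

    -- The position of `i′` once `i` is removed.
    i* : Fin (suc k)
    i* = punchOut i≢i′

    punchIn-i* : punchIn i i* ≡ i′
    punchIn-i* = punchIn-punchOut i≢i′

    q₁ v₁ : Fin (n (link G p))
    q₁ = L.ι⁻¹ pq
    v₁ = L.ι⁻¹ pv

    near₁ : Near (link G p) R.K′ q₁ i*
    near₁ j ne = subst₂ (Adj G) (≡-sym (R.ι-K′ j)) (≡-sym (L.ι-ι⁻¹ pq))
      (near′ _ λ eq → ne (punchIn-injective i j i* (trans eq (≡-sym punchIn-i*))))

    qv₁ : Adj (link G p) q₁ v₁
    qv₁ = subst₂ (Adj G) (≡-sym (L.ι-ι⁻¹ pq)) (≡-sym (L.ι-ι⁻¹ pv)) qv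

    module L′ = Link (link G p) q₁
    module R′ = Restrict (link G p) R.K′ q₁ i* near₁

    ι₂ : Fin (n (link (link G p) q₁)) → Fin (n G)
    ι₂ = L.ι ∘ L′.ι

    ι₂-p : ∀ w → Adj G p (ι₂ w)
    ι₂-p w = L.ι-adj (L′.ι w)

    ι₂-q : ∀ w → Adj G q (ι₂ w)
    ι₂-q w = subst (λ x → Adj G x (ι₂ w)) (L.ι-ι⁻¹ pq) (L′.ι-adj w)

    index₂ : Fin k → Fin (2 + k)
    index₂ j = punchIn i (punchIn i* j)

    ι₂-K′ : ∀ j → ι₂ (R′.K′ j) ≡ K (index₂ j)
    ι₂-K′ j = trans (cong L.ι (R′.ι-K′ j)) (R.ι-K′ (punchIn i* j))

    v₂ : Fin (n (link (link G p) q₁))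
    v₂ = L′.ι⁻¹ qv₁

    ι₂-v : ι₂ v₂ ≡ v
    ι₂-v = trans (cong L.ι (L′.ι-ι⁻¹ qv₁)) (L.ι-ι⁻¹ pv)

    un-index₂ : ∀ j → j ≢ i → j ≢ i′ → ∃ λ j₂ → index₂ j₂ ≡ j
    un-index₂ j j≢i j≢i′ = punchOut i*≢ , trans (cong (punchIn i) (punchIn-punchOut i*≢)) back
      where
      i≢j : i ≢ j
      i≢j = j≢i ∘ ≡-sym
      back : punchIn i (punchOut i≢j) ≡ j
      back = punchIn-punchOut i≢j
      i*≢ : i* ≢ punchOut i≢j
      i*≢ eq = j≢i′ (trans (≡-sym back) (trans (cong (punchIn i) (≡-sym eq)) punchIn-i*))

  common-forced : ∀ {c} → (∀ q (K : Fin k → Fin (n (link (link G p) q))) → Clique (link (link G p) q) K →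
      ∀ v → ∃ (ForcedColour c (link (link G p) q) K v)) →
    ∃ (ForcedOnCommon c G K p q v i i′)
  common-forced {c} forced = conclude (forced q₁ R′.K′ (R′.K′-clique (R.K′-clique cl)) v₂)
    where
    conclude : ∃ (ForcedColour c (link (link G p) q₁) R′.K′ v₂) → ∃ (ForcedOnCommon c G K p q v i i′)
    conclude (j , force) = index₂ j , punchInᵢ≢i i _ ,
      (λ eq → punchInᵢ≢i i* j (punchIn-injective i _ _ (trans eq (≡-sym punchIn-i*)))) ,
      λ χ proper palette → trans (≡-sym (cong χ ι₂-v)) (trans
        (force (χ ∘ ι₂) (λ u w → proper (ι₂ u) (ι₂ w) (ι₂-p u) (ι₂-q u) (ι₂-p w) (ι₂-q w))
          (λ w → let j , j≢i , j≢i′ , eq = palette (ι₂ w) (ι₂-p w) (ι₂-q w)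
                     j₂ , eq₂ = un-index₂ j j≢i j≢i′
                 in j₂ , trans eq (cong χ (≡-sym (trans (ι₂-K′ j₂) (cong K eq₂))))))
        (cong χ (ι₂-K′ j)))

-- Gluing the local colourings

module LocallyColourableCase (b₀ : ℕ) (G : Graph) (lc : LocalColouring (3 + b₀) G)
  (few-misses : ∀ vs k → 3 * length vs ≤ suc k * (3 * (3 + b₀) + 1) → ∃ λ w → misses G w vs ≤ k)
  (near-two : ∀ (K : Fin (4 + b₀) → Fin (n G)) → Clique G K → ∀ u v →
    ∃ λ w → Adj G u w × Adj G v w × ∃ (Near G K w))
  (forced : ∀ p q (K : Fin (2 + b₀) → Fin (n (link (link G p) q))) → Clique (link (link G p) q) K →
    ∀ v → ∃ (ForcedColour (3 + b₀) (link (link G p) q) K v))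
  (K : Fin (4 + b₀) → Fin (n G)) (cl : Clique G K) where

  private
    b : ℕ
    b = 3 + b₀

    V : Set
    V = Fin (n G)

    _~_ : V → V → Set
    _~_ = Adj G

    infix 4 _~_

    κ : V → V → Fin b
    κ = proj₁ lc

    κ-proper : ∀ {p u v} → p ~ u → p ~ v → u ~ v → κ p u ≢ κ p v
    κ-proper = proj₂ lc _ _ _

    ~sym : ∀ {u v} → u ~ v → v ~ u
    ~sym = Adj-sym G

    free : CliqueFree (2 + b) G
    free = localColouring⇒cliqueFree G lc

  κ-injective : ∀ {p i j} → p ~ K i → p ~ K j → κ p (K i) ≡ κ p (K j) → i ≡ j
  κ-injective {p} {i} {j} pi pj eq with i ≟ j
  ... | yes i≡j = i≡j
  ... | no  i≢j = ⊥-elim (κ-proper pi pj (cl i j i≢j) eq)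

  -- The colour that `p` proposes for `v`. `κ p` is informative only on neighbours of `p`, hence the
  -- demand that `K j` be one.
  record Label (v p : V) (j : Fin (suc b)) : Set where
    constructor label
    field
      pv   : p ~ v
      near : ∃ (Near G K p)
      pj   : p ~ K j
      κ≡   : κ p v ≡ κ p (K j)

  Label? : ∀ v p j → Dec (Label v p j)
  Label? v p j = map′ (λ (a , c , d , e) → label a c d e) (λ (label a c d e) → a , c , d , e)
    (T? (E G p v) ×-dec any? (λ i → all? λ j → ¬? (j ≟ i) →-dec T? (E G (K j) p))
      ×-dec T? (E G p (K j)) ×-dec (κ p v ≟ κ p (K j)))

  Label-unique : ∀ {v p j j′} → Label v p j → Label v p j′ → j ≡ j′
  Label-unique (label _ _ pj eq) (label _ _ pj′ eq′) = κ-injective pj pj′ (trans (≡-sym eq) eq′)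

  -- The `b` vertices of `K` adjacent to `p` have distinct colours under `κ p`, so they exhaust all
  -- `b` colours.
  exists-Label : ∀ {v p} → p ~ v → ∃ (Near G K p) → ∃ (Label v p)
  exists-Label {v} {p} pv nr@(i , near) =
    let j , eq = injective⇒surjective (κ p ∘ K ∘ punchIn i) (λ e → punchIn-injective i _ _ (κ-injective (adj _) (adj _) e)) (κ p v)
    in punchIn i j , label pv nr (adj j) (≡-sym eq)
    where open Restrict G K p i near using (adj)

  Label≢near : ∀ {v p i j} → Near G K p i → Label v p j → j ≢ i
  Label≢near {p = p} {i} near (label _ _ pj _) refl = not-all-adjacent G K cl free all-adj
    where
    all-adj : ∀ j → K j ~ p
    all-adj j with j ≟ i
    ... | yes refl = ~sym pj
    ... | no  j≢i  = near j j≢i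

  -- Both κ p and κ q restrict to N(p) ∩ N(q), where the colour of v is forced.
  adjacent-same-label : ∀ {v p q j j′} → Label v p j → Label v q j′ → p ~ q → j ≡ j′
  adjacent-same-label {v} {p} {q} {j} {j′} lp@(label pv (i , near) _ _) lq@(label qv (i′ , near′) _ _) pq =
    conclude (CommonLink.common-forced G K cl pq pv qv near near′ i≢i′ (forced p))
    where
    i≢i′ : i ≢ i′
    i≢i′ refl = near-independent G K cl free near near′ pq
    palette : ∀ {p q i i′} → p ~ q → Near G K p i → Near G K q i′ →
      ∀ w → p ~ w → q ~ w → ∃ λ j → j ≢ i × j ≢ i′ × κ p w ≡ κ p (K j)
    palette {p} {q} {i} {i′} pq near near′ w pw qw with exists-Label pw (i , near) | exists-Label pq (i , near)
    ... | j , l@(label _ _ pj eq) | j₀ , label _ _ pj₀ eq₀ = j , Label≢near near l , j≢i′ , eq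
      where
      -- As `q` is adjacent to the rest of `K`, its colour under `κ p` is that of `K i′`, and `w` is
      -- adjacent to `q`.
      j≢i′ : j ≢ i′
      j≢i′ refl with j₀ ≟ i′
      ... | yes refl = κ-proper pq pw qw (trans eq₀ (≡-sym eq))
      ... | no  ne   = κ-proper pq pj₀ (~sym (near′ j₀ ne)) eq₀
    conclude : ∃ (ForcedOnCommon b G K p q v i i′) → j ≡ j′
    conclude (J , J≢i , J≢i′ , force) = trans
      (Label-unique lp (label pv (i , near) (~sym (near J J≢i))
        (force (κ p) (λ u w pu qu pw qw → κ-proper pu pw) (palette pq near near′))))
      (≡-sym (Label-unique lq (label qv (i′ , near′) (~sym (near′ J J≢i′))
        (force (κ q) (λ u w pu qu pw qw → κ-proper qu qw)
          λ w pw qw → let j , a , b , eq = palette (~sym pq) near′ near w qw pw in j , b , a , eq))))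

  -- A vertex with `P` that misses `K i` is guaranteed a further miss, at `c i`.
  Representatives : (V → Set) → Set
  Representatives P = ∃ λ (c : Fin (suc b) → V) → (∀ i → P (c i)) × (∀ i w → P w → Near G K w i → ¬ c i ~ w)

  representatives : {P : V → Set} → (∀ v → Dec (P v)) → ∀ {p} → P p → Representatives P
  representatives {P} P? {p} Pp = (λ i → proj₁ (rep i)) , (λ i → proj₁ (proj₂ (rep i))) , λ i → proj₂ (proj₂ (rep i))
    where
    rep : ∀ i → ∃ λ c → P c × (∀ w → P w → Near G K w i → ¬ c ~ w)
    rep i with any? (λ c → P? c ×-dec all? (λ j → ¬? (j ≟ i) →-dec T? (E G (K j) c)))
    ... | yes (c , Pc , near) = c , Pc , λ w Pw near′ → near-independent G K cl free near near′
    -- No vertex with `P` is near `K` at `i`, so the condition is vacuous and any vertex with `P`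
    -- will do.
    ... | no  none            = p , Pp , λ w Pw near′ _ → none (w , Pw , near′)

  private
    -- For `b = 3` this reads 99 ≤ 100. For `b = 2` it would read 66 ≤ 56, hence the separate
    -- treatment of that case.
    bound : ∀ b₀ → let b = 3 + b₀ in
      3 * ((b + 2) * (2 + b) + (suc b + suc b)) ≤ suc (2 * b + 3) * (3 * b + 1)
    bound b₀ = ≤-trans (m≤m+n _ (1 + 14 * b₀ + 3 * b₀ * b₀)) (≤-reflexive (solve 1 (λ x → let b = con 3 :+ x in
        con 3 :* ((b :+ con 2) :* (con 2 :+ b) :+ ((con 1 :+ b) :+ (con 1 :+ b))) :+ (con 1 :+ con 14 :* x :+ con 3 :* x :* x) :=
        (con 1 :+ (con 2 :* b :+ con 3)) :* (con 3 :* b :+ con 1)) refl b₀))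
      where open +-*-Solver

  -- A violation would split the neighbours of v that are near K into two parts without edges
  -- between them; choosing a representative of every i in both parts, each vertex then misses too
  -- many vertices of the list below.
  Label-independent : ∀ {v p p′ j j′} → Label v p j → Label v p′ j′ → j ≡ j′
  Label-independent {v} {p} {p′} {j} {j′} lp lp′ with j ≟ j′
  ... | yes j≡j′ = j≡j′
  ... | no  j≢j′ = ⊥-elim (split (representatives (λ r → Label? v r j) lp)
      (representatives (λ r → any? λ j″ → ¬? (j″ ≟ j) ×-dec Label? v r j″) (j′ , j≢j′ ∘ ≡-sym , lp′)))
    where
    split : Representatives (λ r → Label v r j) → Representatives (λ r → ∃ λ j″ → j″ ≢ j × Label v r j″) → ⊥
    split (c , c-label , c-miss) (c′ , c′-label , c′-miss) = absurd (few-misses vs (2 * b + 3) len)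
      where
      -- Two misses in `star`, counted `b + 2` times, exceed the allowed `2b + 3`. As one miss in
      -- `K` is unavoidable, `w` must be adjacent to `v` and near `K`.
      star : List V
      star = v ∷ tabulate K
      vs : List V
      vs = concat (replicate (b + 2) star) ++ (tabulate c ++ tabulate c′)
      len : 3 * length vs ≤ suc (2 * b + 3) * (3 * b + 1)
      len = ≤-trans (≤-reflexive (cong (3 *_) (trans (length-++ (concat (replicate (b + 2) star)))
        (cong₂ _+_ (trans (length-concat-replicate (b + 2) star) (cong (λ l → (b + 2) * suc l) (length-tabulate K)))
          (trans (length-++ (tabulate c)) (cong₂ _+_ (length-tabulate c) (length-tabulate c′))))))) (bound b₀)
      vs-misses : ∀ w → misses G w vs ≡ (b + 2) * misses G w star + (misses G w (tabulate c) + misses G w (tabulate c′))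
      vs-misses w = trans (misses-++ G w (concat (replicate (b + 2) star)) _)
        (cong₂ _+_ (misses-replicate G w (b + 2) star) (misses-++ G w (tabulate c) (tabulate c′)))
      absurd : (∃ λ w → misses G w vs ≤ 2 * b + 3) → ⊥
      absurd (w , few) = dispatch (misses G w star ≤? 1)
        where
        too-many : suc (2 * b + 3) ≤ (b + 2) * misses G w star + (misses G w (tabulate c) + misses G w (tabulate c′)) → ⊥
        too-many le = <⇒≱ (≤-trans le (≤-reflexive (≡-sym (vs-misses w)))) few
        1≤star : 1 ≤ misses G w star
        1≤star = ≤-trans (1≤misses-clique G K cl free w) (m≤n+m _ (miss (E G v w)))
        sum₁ : ∀ {x y} → 1 ≤ x → 2 + b ≤ y → suc (2 * b + 3) ≤ (b + 2) * x + y
        sum₁ {x} {y} lx ly = begin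
          suc (2 * b + 3)          ≡⟨ solve 1 (λ b → con 1 :+ (con 2 :* b :+ con 3) := (b :+ con 2) :* con 1 :+ (con 2 :+ b)) refl b ⟩
          (b + 2) * 1 + (2 + b)    ≤⟨ +-mono-≤ (*-monoʳ-≤ (b + 2) lx) ly ⟩
          (b + 2) * x + y          ∎
          where open ≤-Reasoning
                open +-*-Solver
        sum₂ : ∀ {x y} → 2 ≤ x → suc (2 * b + 3) ≤ (b + 2) * x + y
        sum₂ {x} {y} lx = begin
          suc (2 * b + 3)          ≡⟨ solve 1 (λ b → con 1 :+ (con 2 :* b :+ con 3) := (b :+ con 2) :* con 2) refl b ⟩
          (b + 2) * 2              ≤⟨ *-monoʳ-≤ (b + 2) lx ⟩
          (b + 2) * x              ≤⟨ m≤m+n _ y ⟩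
          (b + 2) * x + y          ∎
          where open ≤-Reasoning
                open +-*-Solver
        -- With label `j`, `w` misses all `b + 1` entries of `c′` by `adjacent-same-label`, and one
        -- of `c`; with another label, the other way round. Together with the miss in `star` this
        -- makes `2b + 4`.
        labelled : ∀ {i} → Near G K w i → ∃ (Label v w) → ⊥
        labelled {i} near (j″ , l) with j″ ≟ j
        ... | yes refl = too-many (sum₁ 1≤star (+-mono-≤ (misses-some G c i (c-miss i w l near))
                (misses-every G c′ λ i′ c′w → let _ , ne , l′ = c′-label i′ in ne (adjacent-same-label l′ l c′w))))
        ... | no  ne   = too-many (sum₁ 1≤star (≤-trans (≤-reflexive (+-comm 1 (suc b)))
                (+-mono-≤ (misses-every G c λ i′ cw → ne (adjacent-same-label l (c-label i′) (~sym cw)))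
                  (misses-some G c′ i (c′-miss i w (j″ , ne , l) near)))))
        dispatch : Dec (misses G w star ≤ 1) → ⊥
        dispatch (no  gt) = too-many (sum₂ (≰⇒> gt))
        dispatch (yes le) with vw ∷ [] , i , near ← one-miss⇒near G K cl free (v ∷ []) le =
          labelled near (exists-Label (~sym vw) (i , near))

  private
    colourOf : ∀ v → ∃ λ j → ∃ λ p → Label v p j
    colourOf v =
      let p , vp , _ , near = near-two K cl v v
          j , l = exists-Label (~sym vp) near
      in j , p , l

    different : ∀ u v → u ~ v → proj₁ (colourOf u) ≢ proj₁ (colourOf v)
    different u v uv eq =
      -- A common neighbour `p` labels both `u` and `v`, and `Label-independent` identifies these
      -- labels with those chosen by `colourOf`.
      let p , up , vp , near = near-two K cl u v
          j , l  = exists-Label (~sym up) near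
          j′ , l′ = exists-Label (~sym vp) near
          j≡j′ = trans (Label-independent l (proj₂ (proj₂ (colourOf u))))
                   (trans eq (Label-independent (proj₂ (proj₂ (colourOf v))) l′))
      in κ-proper (~sym up) (~sym vp) uv (trans (Label.κ≡ l) (trans (cong (κ p ∘ K) j≡j′) (≡-sym (Label.κ≡ l′))))

  colouring : Colourable (suc b) G
  colouring = proj₁ ∘ colourOf , different

-- The upper bound by induction

dense⇒colourable : ∀ {m} b G → Dense m (2 + b) G → LocalColouring (2 + b) G → Colourable (3 + b) G
-- The search over the empty list supplies a vertex to start from.
dense⇒colourable zero    G d lc = LocallyBipartiteCase.3-colourable G lc (find G d) (proj₁ (find G d [] 0 z≤n))
dense⇒colourable (suc b) G d lc =
  let K , cl = exists-clique G d _ ≤-refl in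
  LocallyColourableCase.colouring b G lc (find G d) near-two forced K cl
  where
  free : CliqueFree (5 + b) G
  free = localColouring⇒cliqueFree G lc
  near-two : ∀ (K : Fin (4 + b) → Fin (n G)) → Clique G K → ∀ u v →
    ∃ λ w → Adj G u w × Adj G v w × ∃ (Near G K w)
  near-two K cl u v = rearrange (exists-near G d K cl free (u ∷ v ∷ []) le)
    where
    le : 3 * (2 + (4 + b)) ≤ 2 * (3 * (3 + b) + 1)
    le = ≤-trans (m≤m+n _ (2 + 3 * b)) (≤-reflexive (solve 1 (λ b →
      con 3 :* (con 2 :+ (con 4 :+ b)) :+ (con 2 :+ con 3 :* b) := con 2 :* (con 3 :* (con 3 :+ b) :+ con 1)) refl b))
      where open +-*-Solver
    rearrange : (∃ λ w → All (λ x → Adj G x w) (u ∷ v ∷ []) × ∃ (Near G K w)) →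
      ∃ λ w → Adj G u w × Adj G v w × ∃ (Near G K w)
    rearrange (w , uw ∷ vw ∷ [] , near) = w , uw , vw , near
  forced : ∀ p q (K : Fin (2 + b) → Fin (n (link (link G p) q))) → Clique (link (link G p) q) K →
    ∀ v → ∃ (ForcedColour (3 + b) (link (link G p) q) K v)
  forced p q K cl v = forced-colour (3 + b) b (link (link G p) q) (link-dense (link G p) q (link-dense G p d))
    (link-cliqueFree (link G p) q (link-cliqueFree G p free)) K cl v

-- Links lower `a` and the density parameter by one each, and their colourings make up the local
-- colouring. For `zero` the cliques are single vertices and the hypothesis is itself a local
-- colouring.
locallyBipartite⇒colourable : ∀ {m} a G → Dense m (2 + a) G → LocallyBipartite (suc a) G → Colourable (3 + a) G
locallyBipartite⇒colourable zero G d lb = dense⇒colourable 0 G d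
  ((λ p → proj₁ (at p)) , λ p u v pu pv → proj₂ (at p) u v (λ _ → pu) (λ _ → pv))
  where
  at : ∀ p → Σ (Fin (n G) → Fin 2) λ c →
    ∀ u v → InCommonNbhd G {1} (λ _ → p) u → InCommonNbhd G {1} (λ _ → p) v → Adj G u v → c u ≢ c v
  at p = lb (λ _ → p) (Clique⇒IsClique G _ λ { zero zero ne → ⊥-elim (ne refl) })
locallyBipartite⇒colourable (suc a) G d lb = dense⇒colourable (suc a) G d
  (links-colourable⇒localColouring G λ p →
    locallyBipartite⇒colourable a (link G p) (link-dense G p d) (link-locallyBipartite G p lb))

-- The extremal graphs

-- Adjacent when `u - v` is 2, 3, 4 or 5 modulo 7; adding 7 keeps the truncated subtraction exact.
C₇ᶜ-adjacent : Fin 7 → Fin 7 → Bool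
C₇ᶜ-adjacent u v = let d = (toℕ u + 7 ∸ toℕ v) % 7 in (1 <ᵇ d) ∧ (d <ᵇ 6)

C₇ᶜ : Graph
C₇ᶜ = record
  { n      = 7
  ; E      = C₇ᶜ-adjacent
  ; sym    = from-yes (all? λ u → all? λ v → C₇ᶜ-adjacent u v Bool.≟ C₇ᶜ-adjacent v u)
  ; irrefl = from-yes (all? λ v → C₇ᶜ-adjacent v v Bool.≟ false)
  }

C₇ᶜ-nonDegree : NonDegreeAtMost 3 C₇ᶜ
C₇ᶜ-nonDegree = from-yes (all? λ v → 7 ≤? 3 + deg C₇ᶜ v)

-- N(p) = {p+2, p+3, p+4, p+5} is coloured {p+2, p+3} and {p+4, p+5}.
C₇ᶜ-locallyBipartite : LocallyBipartite 1 C₇ᶜ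
C₇ᶜ-locallyBipartite K _ = colour (K zero) , λ u v u∈ v∈ → proper (K zero) u v (u∈ zero) (v∈ zero)
  where
  colour : Fin 7 → Fin 7 → Fin 2
  colour p u with (toℕ u + 7 ∸ toℕ p) % 7 <ᵇ 4
  ... | true  = zero
  ... | false = suc zero
  proper : ∀ p u v → Adj C₇ᶜ p u → Adj C₇ᶜ p v → Adj C₇ᶜ u v → colour p u ≢ colour p v
  proper = from-yes (all? λ p → all? λ u → all? λ v →
    T? (C₇ᶜ-adjacent p u) →-dec T? (C₇ᶜ-adjacent p v) →-dec T? (C₇ᶜ-adjacent u v) →-dec ¬? (colour p u ≟ colour p v))

fourth-of-three : (a b c d : Fin 3) → a ≢ b → a ≢ c → b ≢ c → d ≢ a → d ≢ b → d ≡ c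
fourth-of-three = from-yes (all? λ (a : Fin 3) → all? λ (b : Fin 3) → all? λ (c : Fin 3) → all? λ (d : Fin 3) →
  ¬? (a ≟ b) →-dec ¬? (a ≟ c) →-dec ¬? (b ≟ c) →-dec ¬? (d ≟ a) →-dec ¬? (d ≟ b) →-dec (d ≟ c))

-- The triangle 0, 2, 4 takes all three colours. Then 6 is coloured like 0, 1 like 2 and 3 like 4,
-- so 5, being adjacent to 0, 2 and 3, has no colour left.
C₇ᶜ-not-3-colourable : ¬ Colourable 3 C₇ᶜ
C₇ᶜ-not-3-colourable (c , proper) = proper v5 v2 tt
  (fourth-of-three (c v0) (c v4) (c v2) (c v5) (proper v0 v4 tt) (proper v0 v2 tt) (proper v4 v2 tt)
    (proper v5 v0 tt) (subst (c v5 ≢_) c3≡c4 (proper v5 v3 tt)))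
  where
  v0 v1 v2 v3 v4 v5 v6 : Fin 7
  v0 = zero
  v1 = suc zero
  v2 = suc (suc zero)
  v3 = suc (suc (suc zero))
  v4 = suc (suc (suc (suc zero)))
  v5 = suc (suc (suc (suc (suc zero))))
  v6 = suc (suc (suc (suc (suc (suc zero)))))
  c6≡c0 : c v6 ≡ c v0
  c6≡c0 = fourth-of-three (c v2) (c v4) (c v0) (c v6) (proper v2 v4 tt) (proper v2 v0 tt) (proper v4 v0 tt)
    (proper v6 v2 tt) (proper v6 v4 tt)
  c1≡c2 : c v1 ≡ c v2
  c1≡c2 = fourth-of-three (c v0) (c v4) (c v2) (c v1) (proper v0 v4 tt) (proper v0 v2 tt) (proper v4 v2 tt)
    (subst (c v1 ≢_) c6≡c0 (proper v1 v6 tt)) (proper v1 v4 tt)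
  c3≡c4 : c v3 ≡ c v4
  c3≡c4 = fourth-of-three (c v0) (c v2) (c v4) (c v3) (proper v0 v2 tt) (proper v0 v4 tt) (proper v2 v4 tt)
    (proper v3 v0 tt) (subst (c v3 ≢_) c1≡c2 (proper v3 v1 tt))

join₃-adjacent : ∀ G → Fin 3 ⊎ Fin (n G) → Fin 3 ⊎ Fin (n G) → Bool
join₃-adjacent G (inj₁ _) (inj₁ _) = false
join₃-adjacent G (inj₁ _) (inj₂ _) = true
join₃-adjacent G (inj₂ _) (inj₁ _) = true
join₃-adjacent G (inj₂ u) (inj₂ v) = E G u v

-- Three new vertices preserve the bound 3 on non-neighbours and raise the order by 3, in step with
-- `3ℓ + 1`.
join₃ : Graph → Graph
join₃ G = record
  { n      = 3 + n G
  ; E      = λ u v → join₃-adjacent G (splitAt 3 u) (splitAt 3 v)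
  ; sym    = λ u v → sym′ (splitAt 3 u) (splitAt 3 v)
  ; irrefl = λ v → irrefl′ (splitAt 3 v)
  }
  where
  sym′ : ∀ x y → join₃-adjacent G x y ≡ join₃-adjacent G y x
  sym′ (inj₁ _) (inj₁ _) = refl
  sym′ (inj₁ _) (inj₂ _) = refl
  sym′ (inj₂ _) (inj₁ _) = refl
  sym′ (inj₂ u) (inj₂ v) = sym G u v
  irrefl′ : ∀ x → join₃-adjacent G x x ≡ false
  irrefl′ (inj₁ _) = refl
  irrefl′ (inj₂ v) = irrefl G v

old : ∀ G → Fin (n G) → Fin (n (join₃ G))
old G = 3 ↑ʳ_

join₃-deg : ∀ G v → deg (join₃ G) v ≡
  length (filterᵇ (join₃-adjacent G (splitAt 3 v) ∘ splitAt 3) (zero ∷ suc zero ∷ suc (suc zero) ∷ map (old G) (allFin (n G))))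
join₃-deg G v = cong (λ xs → length (filterᵇ (join₃-adjacent G (splitAt 3 v) ∘ splitAt 3)
  (zero ∷ suc zero ∷ suc (suc zero) ∷ xs))) (≡-sym (map-tabulate id (old G)))

filterᵇ-true : ∀ {A : Set} (xs : List A) → length (filterᵇ (λ _ → true) xs) ≡ length xs
filterᵇ-true []       = refl
filterᵇ-true (x ∷ xs) = cong suc (filterᵇ-true xs)

join₃-nonDegree : ∀ G → NonDegreeAtMost 3 G → NonDegreeAtMost 3 (join₃ G)
join₃-nonDegree G bd v = ≤-trans (bound (splitAt 3 v)) (≤-reflexive (cong (3 +_) (≡-sym (join₃-deg G v))))
  where
  bound : ∀ x → 3 + n G ≤ 3 + length (filterᵇ (join₃-adjacent G x ∘ splitAt 3)
    (zero ∷ suc zero ∷ suc (suc zero) ∷ map (old G) (allFin (n G))))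
  bound (inj₁ _) = +-monoʳ-≤ 3 (≤-reflexive (≡-sym (trans
    (length-filterᵇ-map _ (old G) (allFin (n G))) (trans (filterᵇ-true (allFin (n G))) (length-allFin (n G))))))
  bound (inj₂ u) = +-monoʳ-≤ 3 (≤-trans (bd u) (+-monoʳ-≤ 3 (≤-reflexive (≡-sym
    (length-filterᵇ-map (join₃-adjacent G (inj₂ u) ∘ splitAt 3) (old G) (allFin (n G)))))))

-- The colour of a new vertex is absent from `G` and can be removed.
join₃-colourable : ∀ {k} G → Colourable (suc k) (join₃ G) → Colourable k G
join₃-colourable G (c , proper) = (λ v → punchOut (avoid v)) ,
  λ u v uv eq → proper (old G u) (old G v) uv (punchOut-injective (avoid u) (avoid v) eq)
  where
  avoid : ∀ v → c zero ≢ c (old G v)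
  avoid v = proper zero (old G v) tt

-- An edge `u v` would form a triangle with `K zero` in the common neighbourhood of the other `a`
-- vertices of `K`.
locallyBipartite⇒common-independent : ∀ {a} G → LocallyBipartite a G → (K : Fin (suc a) → Fin (n G)) → Clique G K →
  ∀ u v → InCommonNbhd G K u → InCommonNbhd G K v → ¬ Adj G u v
locallyBipartite⇒common-independent G lb K cl u v u∈ v∈ uv =
  let c , proper = lb (K ∘ suc) (Clique⇒IsClique G _ (clique-∘ G K suc Fin.suc-injective cl))
      K₀∈ = λ i → cl (suc i) zero λ ()
  in fin2 _ _ _ (proper (K zero) u K₀∈ (u∈ ∘ suc) (u∈ zero)) (proper u v (u∈ ∘ suc) (v∈ ∘ suc) uv)
       (proper (K zero) v K₀∈ (v∈ ∘ suc) (v∈ zero))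

module Join₃ {a : ℕ} (G : Graph) (lb : LocallyBipartite a G) (K : Fin (suc a) → Fin 3 ⊎ Fin (n G))
  (cl : ∀ i j → i ≢ j → T (join₃-adjacent G (K i) (K j))) where

  private
    V′ : Set
    V′ = Fin 3 ⊎ Fin (n G)

    Old : V′ → Set
    Old x = ∃ λ u → x ≡ inj₂ u

    neighbour-old : ∀ {x} y {t} → x ≡ inj₁ t → T (join₃-adjacent G x y) → Old y
    neighbour-old (inj₂ u) refl _ = u , refl

    restrict : ∀ x y ((u , _) : Old x) ((v , _) : Old y) → T (join₃-adjacent G x y) → Adj G u v
    restrict _ _ (u , refl) (v , refl) uv = uv

    find-new : (∃₂ λ i t → K i ≡ inj₁ t) ⊎ (∀ i → Old (K i))
    find-new with any? (λ i → new? (K i))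
      where
      new? : ∀ x → Dec (∃ λ t → x ≡ inj₁ t)
      new? (inj₁ t) = yes (t , refl)
      new? (inj₂ u) = no λ ()
    ... | yes (i , t , eq) = inj₁ (i , t , eq)
    ... | no  none         = inj₂ λ i → old′ (K i) (λ t eq → none (i , t , eq))
      where
      old′ : ∀ x → (∀ t → x ≢ inj₁ t) → Old x
      old′ (inj₁ t) ne = ⊥-elim (ne t refl)
      old′ (inj₂ u) ne = u , refl

  Bipartition : Set
  Bipartition = Σ (V′ → Fin 2) λ c → ∀ x y → (∀ i → T (join₃-adjacent G (K i) x)) →
    (∀ i → T (join₃-adjacent G (K i) y)) → T (join₃-adjacent G x y) → c x ≢ c y

  -- All other vertices of `K` and their common neighbours with `K i` are old, so the bipartition
  -- comes from `G` and `K` without `K i`.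
  through-new : ∀ i {t} → K i ≡ inj₁ t → Bipartition
  through-new i eq = colour , λ x y x∈ y∈ → proper x y (neighbour-old x eq (x∈ i)) (neighbour-old y eq (y∈ i)) x∈ y∈
    where
    K-old : ∀ j → Old (K (punchIn i j))
    K-old j = neighbour-old (K (punchIn i j)) eq (cl i (punchIn i j) (punchInᵢ≢i i j ∘ ≡-sym))
    K′ : Fin a → Fin (n G)
    K′ j = proj₁ (K-old j)
    K′-clique : Clique G K′
    K′-clique j j′ ne = restrict _ _ (K-old j) (K-old j′) (cl _ _ (ne ∘ punchIn-injective i j j′))
    c : Fin (n G) → Fin 2
    c = proj₁ (lb K′ (Clique⇒IsClique G K′ K′-clique))
    colour : V′ → Fin 2
    colour (inj₁ _) = zero
    colour (inj₂ u) = c u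
    proper : ∀ x y → Old x → Old y → (∀ i → T (join₃-adjacent G (K i) x)) →
      (∀ i → T (join₃-adjacent G (K i) y)) → T (join₃-adjacent G x y) → colour x ≢ colour y
    proper x y (u , refl) (v , refl) u∈ v∈ uv = proj₂ (lb K′ (Clique⇒IsClique G K′ K′-clique)) u v
      (λ j → restrict _ x (K-old j) (u , refl) (u∈ (punchIn i j)))
      (λ j → restrict _ y (K-old j) (v , refl) (v∈ (punchIn i j))) uv

  -- The old common neighbours are independent, and so are the new vertices.
  all-old : (∀ i → Old (K i)) → Bipartition
  all-old K-old = colour , proper
    where
    colour : V′ → Fin 2
    colour (inj₁ _) = zero
    colour (inj₂ _) = suc zero
    proper : ∀ x y → (∀ i → T (join₃-adjacent G (K i) x)) → (∀ i → T (join₃-adjacent G (K i) y)) →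
      T (join₃-adjacent G x y) → colour x ≢ colour y
    proper (inj₁ _) (inj₂ _) _ _ _ ()
    proper (inj₂ _) (inj₁ _) _ _ _ ()
    proper (inj₂ u) (inj₂ v) u∈ v∈ uv _ = locallyBipartite⇒common-independent G lb (proj₁ ∘ K-old)
      (λ i j ne → restrict _ _ (K-old i) (K-old j) (cl i j ne)) u v
      (λ i → restrict _ (inj₂ u) (K-old i) (u , refl) (u∈ i)) (λ i → restrict _ (inj₂ v) (K-old i) (v , refl) (v∈ i)) uv

  bipartition : Bipartition
  bipartition with find-new
  ... | inj₁ (i , _ , eq) = through-new i eq
  ... | inj₂ K-old        = all-old K-old

join₃-locallyBipartite : ∀ {a} G → LocallyBipartite a G → LocallyBipartite (suc a) (join₃ G)
join₃-locallyBipartite G lb K (_ , cl) =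
  let c , proper = Join₃.bipartition G lb (splitAt 3 ∘ K) cl
  in c ∘ splitAt 3 , λ u v → proper (splitAt 3 u) (splitAt 3 v)

extremal : ℕ → Graph
extremal zero    = C₇ᶜ
extremal (suc a) = join₃ (extremal a)

extremal-n : ∀ a → n (extremal a) ≡ 3 * (a + 2) + 1
extremal-n zero    = refl
extremal-n (suc a) = trans (cong (3 +_) (extremal-n a)) (cong (_+ 1) (≡-sym (*-distribˡ-+ 3 1 (a + 2))))

extremal-nonDegree : ∀ a → NonDegreeAtMost 3 (extremal a)
extremal-nonDegree zero    = C₇ᶜ-nonDegree
extremal-nonDegree (suc a) = join₃-nonDegree (extremal a) (extremal-nonDegree a)

extremal-locallyBipartite : ∀ a → LocallyBipartite (suc a) (extremal a)
extremal-locallyBipartite zero    = C₇ᶜ-locallyBipartite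
extremal-locallyBipartite (suc a) = join₃-locallyBipartite (extremal a) (extremal-locallyBipartite a)

extremal-not-colourable : ∀ a → ¬ Colourable (3 + a) (extremal a)
extremal-not-colourable zero    col = C₇ᶜ-not-3-colourable col
extremal-not-colourable (suc a) col = extremal-not-colourable a (join₃-colourable (extremal a) col)

-- Degrees and the rational threshold

open import Data.Integer using (+_; +≤+)

toℚᵘ-ℕ : ∀ x → toℚᵘ (ℕ→ℚ x) ≃ mkℚᵘ (+ x) 0
toℚᵘ-ℕ x = ℚ.toℚᵘ-fromℚᵘ (mkℚᵘ (+ x) 0)

-- Unnormalised, so that numerator and denominator compute without a gcd.
scaledThreshold : ℕ → ℕ → ℚᵘ
scaledThreshold ℓ x = (1ℚᵘ ℚᵘ.+ ℚᵘ.- mkℚᵘ (+ 3) (3 * ℓ)) ℚᵘ.* mkℚᵘ (+ x) 0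

toℚᵘ-threshold : ∀ ℓ x → toℚᵘ (thresholdValue ℓ ℚ.* ℕ→ℚ x) ≃ scaledThreshold ℓ x
toℚᵘ-threshold ℓ x = ℚᵘ.≃-trans (ℚ.toℚᵘ-homo-* (thresholdValue ℓ) (ℕ→ℚ x))
  (ℚᵘ.*-cong (ℚᵘ.≃-trans (ℚ.toℚᵘ-homo-+ 1ℚ (ℚ.- r)) (ℚᵘ.+-congʳ 1ℚᵘ
      (ℚᵘ.≃-trans (ℚ.toℚᵘ-homo‿- r) (ℚᵘ.-‿cong (ℚ.toℚᵘ-fromℚᵘ (mkℚᵘ (+ 3) (3 * ℓ)))))))
    (toℚᵘ-ℕ x))
  where r = (+ 3) ℚ./ suc (3 * ℓ)

numerator : ∀ N x → (+ 1 ℤ.* N ℤ.+ ℤ.- (+ 3) ℤ.* + 1) ℤ.* x ℤ.* + 1 ≡ N ℤ.* x ℤ.- + 3 ℤ.* x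
numerator = solve 2 (λ N x → (con (+ 1) :* N :+ :- con (+ 3) :* con (+ 1)) :* x :* con (+ 1) := N :* x :- con (+ 3) :* x) refl
  where open ℤSolver.+-*-Solver

-- The two cross products in comparing the scaled threshold with `d`.
cross : ∀ ℓ x d → let q = scaledThreshold ℓ x; N = suc (3 * ℓ) in
  (ℚᵘ.↥ q ℤ.* + 1 ≡ + (N * x) ℤ.- + (3 * x)) × (+ d ℤ.* ℚᵘ.↧ q ≡ + (N * d))
cross ℓ x d =
  trans (numerator (+ N) (+ x)) (cong₂ ℤ._-_ (≡-sym (ℤ.pos-* N x)) (≡-sym (ℤ.pos-* 3 x))) ,
  trans (cong (λ z → + d ℤ.* + z) (trans (*-identityʳ (1 * N)) (*-identityˡ N)))
    (trans (ℤ.*-comm (+ d) (+ N)) (≡-sym (ℤ.pos-* N d)))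
  where N = suc (3 * ℓ)

threshold-< : ∀ ℓ x d → thresholdValue ℓ ℚ.* ℕ→ℚ x ℚ.< ℕ→ℚ d → suc (3 * ℓ) * x < suc (3 * ℓ) * d + 3 * x
threshold-< ℓ x d lt = ℤ.drop‿+<+ (begin-strict
  + (N * x)                               ≡⟨ ℤ-cancel (+ (N * x)) (+ (3 * x)) ⟨
  + (N * x) ℤ.- + (3 * x) ℤ.+ + (3 * x)   <⟨ ℤ.+-monoˡ-< (+ (3 * x)) (subst₂ ℤ._<_ (proj₁ (cross ℓ x d)) (proj₂ (cross ℓ x d)) (ℚᵘ.drop-*<* lt′)) ⟩
  + (N * d) ℤ.+ + (3 * x)                 ≡⟨ ℤ.pos-+ (N * d) (3 * x) ⟨
  + (N * d + 3 * x)                       ∎)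
  where
  open ℤ.≤-Reasoning
  N = suc (3 * ℓ)
  ℤ-cancel : ∀ a b → a ℤ.- b ℤ.+ b ≡ a
  ℤ-cancel = solve 2 (λ a b → a :- b :+ b := a) refl
    where open ℤSolver.+-*-Solver
  lt′ : scaledThreshold ℓ x ℚᵘ.< mkℚᵘ (+ d) 0
  lt′ = ℚᵘ.<-respˡ-≃ (toℚᵘ-threshold ℓ x) (ℚᵘ.<-respʳ-≃ (toℚᵘ-ℕ d) (ℚ.toℚᵘ-mono-< lt))

threshold-≤ : ∀ ℓ x d → suc (3 * ℓ) * x ≤ suc (3 * ℓ) * d + 3 * x → thresholdValue ℓ ℚ.* ℕ→ℚ x ℚ.≤ ℕ→ℚ d
threshold-≤ ℓ x d le = ℚ.toℚᵘ-cancel-≤ (ℚᵘ.≤-respˡ-≃ (ℚᵘ.≃-sym (toℚᵘ-threshold ℓ x))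
  (ℚᵘ.≤-respʳ-≃ (ℚᵘ.≃-sym (toℚᵘ-ℕ d)) (ℚᵘ.*≤* (subst₂ ℤ._≤_ (≡-sym (proj₁ (cross ℓ x d))) (≡-sym (proj₂ (cross ℓ x d))) (begin
    + (N * x) ℤ.- + (3 * x)               ≤⟨ ℤ.+-monoˡ-≤ (ℤ.- + (3 * x)) (+≤+ le) ⟩
    + (N * d + 3 * x) ℤ.- + (3 * x)       ≡⟨ cong (ℤ._- + (3 * x)) (ℤ.pos-+ (N * d) (3 * x)) ⟩
    + (N * d) ℤ.+ + (3 * x) ℤ.- + (3 * x) ≡⟨ ℤ-cancel (+ (N * d)) (+ (3 * x)) ⟩
    + (N * d)                             ∎)))))
  where
  open ℤ.≤-Reasoning
  N = suc (3 * ℓ)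
  ℤ-cancel : ∀ a b → a ℤ.+ b ℤ.- b ≡ a
  ℤ-cancel = solve 2 (λ a b → a :+ b :- b := a) refl
    where open ℤSolver.+-*-Solver

-- The bound m is the largest integer below 3 |G| / (3ℓ+1).
minDegree⇒dense : ∀ ℓ G {N} → n G ≡ suc N → (∀ v → suc (3 * ℓ) * n G < suc (3 * ℓ) * deg G v + 3 * n G) →
  Dense ((2 + 3 * N) / suc (3 * ℓ)) ℓ G
minDegree⇒dense ℓ G {N} eq lt = record
  { nonDegree = λ v → add-back (bound v)
  ; large     = begin-strict
      (3 * ℓ + 1) * m      ≡⟨ cong (_* m) (+-comm (3 * ℓ) 1) ⟩
      D * m                ≡⟨ *-comm D m ⟩
      m * D                ≤⟨ m/n*n≤m (2 + 3 * N) D ⟩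
      2 + 3 * N            <⟨ n<1+n _ ⟩
      3 + 3 * N            ≡⟨ 3n≡ ⟨
      3 * n G              ∎
  }
  where
  open ≤-Reasoning
  D = suc (3 * ℓ)
  -- `2 + 3 * N` is `3 |G| - 1`, so rounding down keeps the bound strict.
  m = (2 + 3 * N) / D
  3n≡ : 3 * n G ≡ 3 + 3 * N
  3n≡ = trans (cong (3 *_) eq) (*-suc 3 N)
  add-back : ∀ {a b c} → a ∸ b ≤ c → a ≤ c + b
  add-back {a} {b} {c} le = ≤-trans (m≤n+m∸n a b) (≤-trans (+-monoʳ-≤ b le) (≤-reflexive (+-comm b c)))
  bound : ∀ v → n G ∸ deg G v ≤ m
  bound v = begin
    n G ∸ deg G v              ≡⟨ m*n/n≡m (n G ∸ deg G v) D ⟨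
    (n G ∸ deg G v) * D / D    ≤⟨ /-monoˡ-≤ D (≤-pred (begin-strict
      (n G ∸ deg G v) * D        ≡⟨ *-comm (n G ∸ deg G v) D ⟩
      D * (n G ∸ deg G v)        ≡⟨ *-distribˡ-∸ D (n G) (deg G v) ⟩
      D * n G ∸ D * deg G v      <⟨ subtract (D * n G) (D * deg G v) (lt v) ⟩
      3 * n G                    ≡⟨ 3n≡ ⟩
      3 + 3 * N                  ∎)) ⟩
    m                          ∎
    where
    subtract : ∀ a b → a < b + 3 * n G → a ∸ b < 3 * n G
    subtract a b l = m<n+o⇒m∸n<o a b {{>-nonZero (≤-trans (s≤s z≤n) (≤-reflexive (≡-sym 3n≡)))}} l

above-threshold-forces : ∀ a d → thresholdValue (2 + a) ℚ.< d → Forces (LocallyBipartite (suc a)) (3 + a) d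
above-threshold-forces a d c<d G lb md = by-size (n G) refl
  where
  by-size : ∀ k → n G ≡ k → Colourable (3 + a) G
  -- Scaling by `|G|` keeps `c<d` strict only for positive `|G|`, so the empty graph is treated
  -- apart.
  by-size zero    eq = (λ v → ⊥-elim (¬Fin0 (subst Fin eq v))) , λ u → ⊥-elim (¬Fin0 (subst Fin eq u))
  by-size (suc N) eq = locallyBipartite⇒colourable a G (minDegree⇒dense (2 + a) G eq degrees) lb
    where
    scaled : thresholdValue (2 + a) ℚ.* ℕ→ℚ (n G) ℚ.< d ℚ.* ℕ→ℚ (n G)
    scaled = ℚ.*-monoˡ-<-pos (ℕ→ℚ (n G)) {{positive}} c<d
      where
      positive : ℚ.Positive (ℕ→ℚ (n G))
      positive = subst (λ k → ℚ.Positive (ℕ→ℚ k)) (≡-sym eq) (ℚ.normalize-pos (suc N) 1)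
    degrees : ∀ v → suc (3 * (2 + a)) * n G < suc (3 * (2 + a)) * deg G v + 3 * n G
    degrees v = threshold-< (2 + a) (n G) (deg G v) (ℚ.<-≤-trans scaled (md v))

-- The minimum degree of the extremal graph reaches the threshold itself, so one graph refutes every
-- smaller `d`.
below-threshold-fails : ∀ a d → d ℚ.< thresholdValue (2 + a) → ¬ Forces (LocallyBipartite (suc a)) (3 + a) d
below-threshold-fails a d d<c forces = extremal-not-colourable a (forces (extremal a) (extremal-locallyBipartite a) degrees)
  where
  N = n (extremal a)
  N≡ : N ≡ suc (3 * (2 + a))
  N≡ = trans (extremal-n a) (trans (+-comm (3 * (a + 2)) 1) (cong (λ z → suc (3 * z)) (+-comm a 2)))
  degrees : MinDegAtLeast (extremal a) d
  degrees v = ℚ.≤-trans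
    (ℚ.*-monoʳ-≤-nonNeg (ℕ→ℚ N) {{ℚ.normalize-nonNeg N 1}} (ℚ.<⇒≤ d<c))
    (threshold-≤ (2 + a) N (deg (extremal a) v) (begin
      D * N                               ≤⟨ *-monoʳ-≤ D (extremal-nonDegree a v) ⟩
      D * (3 + deg (extremal a) v)        ≡⟨ *-distribˡ-+ D 3 (deg (extremal a) v) ⟩
      D * 3 + D * deg (extremal a) v      ≡⟨ +-comm (D * 3) _ ⟩
      -- The order of the extremal graph is exactly `D`.
      D * deg (extremal a) v + D * 3      ≡⟨ cong (λ z → D * deg (extremal a) v + z) (trans (*-comm D 3) (cong (3 *_) (≡-sym N≡))) ⟩
      D * deg (extremal a) v + 3 * N      ∎))
    where
    open ≤-Reasoning
    D = suc (3 * (2 + a))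

theorem1p4 : (a : ℕ) → 1 ≤ a → let ℓ = a + 1 in
    ChromaticThresholdIs (LocallyBipartite a) (ℓ + 1) (thresholdValue ℓ)
theorem1p4 (suc a) _ = subst (λ ℓ → ChromaticThresholdIs (LocallyBipartite (suc a)) (ℓ + 1) (thresholdValue ℓ))
  (≡-sym (+-comm (suc a) 1))
  (subst (λ k → ChromaticThresholdIs (LocallyBipartite (suc a)) k (thresholdValue (2 + a)))
    (+-comm 1 (2 + a)) (above-threshold-forces a , below-threshold-fails a))
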